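{- There is an absolute constant $C$ such that for every integer $m\ge 2$, with $p=2^m-1$, and every $k\in\mathbb{Z}_p$, the Pollard Rho walk with parameter $k$ on the cycle $\mathbb{Z}_p$ has mixing time in separation distance satisfying $$\tau_s(1/2)\le C\,\log p\,\log\log p .$$
   Context: The Pollard Rho walk with parameter $k$ on $\mathbb{Z}_p$ ($p$ odd) is the Markov chain which at each step moves from $i$ to $i+1$, to $i+k$, or to $2i$ (all modulo $p$), each with probability $1/3$ (probabilities of coinciding targets are added). Its stationary distribution $\pi$ is uniform on $\mathbb{Z}_p$. For a Markov chain with transition matrix $P$ on a finite state space $V$ and stationary distribution $\pi$, the mixing time in separation distance is $$\tau_s(\epsilon)=\min\Bigl\{n:\ \forall x,y\in V,\ 1-\frac{P^n(x,y)}{\pi(y)}\le\epsilon\Bigr\}.$$ Logarithms are natural. -}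

module Defs where

open import Data.Nat.Base as ℕ using (ℕ; zero; suc)
import Data.Nat.Properties as ℕ
import Data.Nat.DivMod as ℕ
open import Data.Fin.Base using (Fin; zero; suc; toℕ)
import Data.Fin.Properties as Fin
open import Data.Bool.Base using (if_then_else_)
open import Data.Integer.Base as ℤ using (+_; -[1+_])
import Data.Integer.Properties as ℤ
open import Data.Rational.Base
open import Data.Rational.Properties
import Data.Rational.Unnormalised.Base as ℚᵘ
import Data.Rational.Unnormalised.Properties as ℚᵘ
open import Data.Rational.Solver using (module +-*-Solver)
open import Data.Product.Base using (Σ; ∃-syntax; _×_; _,_; proj₁; proj₂)
open import Data.Sum.Base using (inj₁; inj₂; [_,_]′)
open import Relation.Nullary.Decidable using (does; yes; no; does-⇔)
open import Function.Bundles using (mk⇔)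
open import Algebra.Bundles using (CommutativeRing)
open import Relation.Binary.PropositionalEquality
  using (_≡_; refl; sym; trans; cong; cong₂; subst; subst₂; module ≡-Reasoning)
open import Algebra.Definitions.RawSemiring +-*-rawSemiring using (_^_)
open import Algebra.Properties.Semiring.Sum (CommutativeRing.semiring +-*-commutativeRing)
  using (sum-syntax; sum-cong-≗; ∑-distrib-+; *-distribˡ-sum; sum-replicate-zero)

private
  mulˡ : ∀ {a b c} → 0ℚ ≤ a → b ≤ c → a * b ≤ a * c
  mulˡ {a} 0≤a = *-monoˡ-≤-nonNeg a {{nonNegative 0≤a}}

  mulʳ : ∀ {a b c} → 0ℚ ≤ a → b ≤ c → b * a ≤ c * a
  mulʳ {a} 0≤a = *-monoʳ-≤-nonNeg a {{nonNegative 0≤a}}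

  mul-mono : ∀ {a b c d} → 0ℚ ≤ a → 0ℚ ≤ d → a ≤ b → c ≤ d → a * c ≤ b * d
  mul-mono 0≤a 0≤d a≤b c≤d = ≤-trans (mulˡ 0≤a c≤d) (mulʳ 0≤d a≤b)

  0≤* : ∀ {a b} → 0ℚ ≤ a → 0ℚ ≤ b → 0ℚ ≤ a * b
  0≤* {a} {b} 0≤a 0≤b = subst (_≤ a * b) (*-zeroʳ a) (mulˡ 0≤a 0≤b)

  0<* : ∀ {a b} → 0ℚ < a → 0ℚ < b → 0ℚ < a * b
  0<* {a} {b} 0<a 0<b =
    subst (_< a * b) (*-zeroʳ a) (*-monoʳ-<-pos a {{positive 0<a}} 0<b)

  0<+ : ∀ {a b} → 0ℚ < a → 0ℚ ≤ b → 0ℚ < a + b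
  0<+ 0<a 0≤b = +-mono-<-≤ 0<a 0≤b

  0≤+ : ∀ {a b} → 0ℚ ≤ a → 0ℚ ≤ b → 0ℚ ≤ a + b
  0≤+ 0≤a 0≤b = +-mono-≤ 0≤a 0≤b

  ≤-+ʳ : ∀ {a b} → 0ℚ ≤ b → a ≤ a + b
  ≤-+ʳ {a} {b} 0≤b = subst (_≤ a + b) (+-identityʳ a) (+-monoʳ-≤ a 0≤b)

  ≤⇒0≤- : ∀ {a b} → a ≤ b → 0ℚ ≤ b - a
  ≤⇒0≤- {a} {b} a≤b = subst (_≤ b - a) (+-inverseʳ a) (+-monoˡ-≤ (- a) a≤b)

  0≤-⇒≤ : ∀ {a b} → 0ℚ ≤ b - a → a ≤ b
  0≤-⇒≤ {a} {b} p = subst₂ _≤_ (+-identityˡ a) lem (+-monoˡ-≤ a p)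
    where
    open +-*-Solver
    lem : b - a + a ≡ b
    lem = solve 2 (λ a b → b :- a :+ a := b) refl a b

  0<1 : 0ℚ < 1ℚ
  0<1 = *<* (ℤ.+<+ (ℕ.s≤s ℕ.z≤n))

  0≤1 : 0ℚ ≤ 1ℚ
  0≤1 = <⇒≤ 0<1

  abs≤ : ∀ {a e} → a ≤ e → - a ≤ e → ∣ a ∣ ≤ e
  abs≤ {a} {e} p q with ∣p∣≡p∨∣p∣≡-p a
  ... | inj₁ eq = subst (_≤ e) (sym eq) p
  ... | inj₂ eq = subst (_≤ e) (sym eq) q

  ≤abs : ∀ a → a ≤ ∣ a ∣
  ≤abs a with ≤-total 0ℚ a
  ... | inj₁ 0≤a = ≤-reflexive (sym (0≤p⇒∣p∣≡p 0≤a))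
  ... | inj₂ a≤0 = ≤-trans a≤0 (0≤∣p∣ a)

  abs-sym : ∀ a b → ∣ a - b ∣ ≡ ∣ b - a ∣
  abs-sym a b = trans (cong ∣_∣ lem) (∣-p∣≡∣p∣ (b - a))
    where
    open +-*-Solver
    lem : a - b ≡ - (b - a)
    lem = solve 2 (λ a b → a :- b := :- (b :- a)) refl a b

  abs-tri : ∀ a b c → ∣ a - c ∣ ≤ ∣ a - b ∣ + ∣ b - c ∣
  abs-tri a b c = subst (λ d → ∣ d ∣ ≤ ∣ a - b ∣ + ∣ b - c ∣) lem (∣p+q∣≤∣p∣+∣q∣ (a - b) (b - c))
    where
    open +-*-Solver
    lem : a - b + (b - c) ≡ a - c
    lem = solve 3 (λ a b c → a :- b :+ (b :- c) := a :- c) refl a b c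

  abs-from : ∀ a b → ∣ a ∣ ≤ ∣ b ∣ + ∣ a - b ∣
  abs-from a b = subst (λ d → ∣ d ∣ ≤ ∣ b ∣ + ∣ a - b ∣) lem (∣p+q∣≤∣p∣+∣q∣ b (a - b))
    where
    open +-*-Solver
    lem : b + (a - b) ≡ a
    lem = solve 2 (λ a b → b :+ (a :- b) := a) refl a b

  abs-abs : ∀ a b → ∣ ∣ a ∣ - ∣ b ∣ ∣ ≤ ∣ a - b ∣
  abs-abs a b = abs≤ (half a b)
    (subst₂ _≤_ lem (abs-sym b a) (half b a))
    where
    open +-*-Solver
    lem : ∣ b ∣ - ∣ a ∣ ≡ - (∣ a ∣ - ∣ b ∣)
    lem = solve 2 (λ a b → b :- a := :- (a :- b)) refl ∣ a ∣ ∣ b ∣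
    half : ∀ a b → ∣ a ∣ - ∣ b ∣ ≤ ∣ a - b ∣
    half a b = subst (∣ a ∣ - ∣ b ∣ ≤_) lem′ (+-monoˡ-≤ (- ∣ b ∣) (abs-from a b))
      where
      lem′ : ∣ b ∣ + ∣ a - b ∣ - ∣ b ∣ ≡ ∣ a - b ∣
      lem′ = solve 2 (λ b d → b :+ d :- b := d) refl ∣ b ∣ ∣ a - b ∣

  inv : (a : ℚ) → 0ℚ < a → ∃[ u ] 0ℚ < u × u * a ≡ 1ℚ
  inv a 0<a = 1/ a , positive⁻¹ (1/ a) {{1/pos⇒pos a}} , *-inverseˡ a
    where
    instance
      _ = positive 0<a
      _ = pos⇒nonZero a

fromℕ : ℕ → ℚ
fromℕ n = + n / 1

private
  fromℕ≃ : ∀ n → toℚᵘ (fromℕ n) ℚᵘ.≃ ℚᵘ.mkℚᵘ (+ n) 0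
  fromℕ≃ n = toℚᵘ-fromℚᵘ (ℚᵘ.mkℚᵘ (+ n) 0)

  fromℕ-suc : ∀ n → fromℕ (suc n) ≡ 1ℚ + fromℕ n
  fromℕ-suc n = toℚᵘ-injective (ℚᵘ.≃-trans (fromℕ≃ (suc n)) (ℚᵘ.≃-sym
    (ℚᵘ.≃-trans (toℚᵘ-homo-+ 1ℚ (fromℕ n))
      (ℚᵘ.≃-trans (ℚᵘ.+-cong (ℚᵘ.≃-refl {toℚᵘ 1ℚ}) (fromℕ≃ n)) (ℚᵘ.*≡* lem)))))
    where
    lem : (ℤ.1ℤ ℤ.* ℤ.1ℤ ℤ.+ (+ n) ℤ.* ℤ.1ℤ) ℤ.* ℤ.1ℤ ≡ (+ suc n) ℤ.* (ℤ.1ℤ ℤ.* ℤ.1ℤ)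
    lem rewrite ℤ.*-identityʳ (+ n) | ℤ.*-identityʳ (+ suc n) = refl

  0≤fromℕ : ∀ n → 0ℚ ≤ fromℕ n
  0≤fromℕ n = nonNegative⁻¹ (fromℕ n) {{normalize-nonNeg n 1}}

  0</ : ∀ a n → 0ℚ < + suc a / suc n
  0</ a n = positive⁻¹ (+ suc a / suc n) {{normalize-pos (suc a) (suc n)}}

  /-* : ∀ a n → (+ a / suc n) * fromℕ (suc n) ≡ fromℕ a
  /-* a n = toℚᵘ-injective
    (ℚᵘ.≃-trans (toℚᵘ-homo-* (+ a / suc n) (fromℕ (suc n)))
    (ℚᵘ.≃-trans (ℚᵘ.*-cong (toℚᵘ-fromℚᵘ (ℚᵘ.mkℚᵘ (+ a) n)) (fromℕ≃ (suc n)))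
    (ℚᵘ.≃-trans (ℚᵘ.*≡* lem) (ℚᵘ.≃-sym (fromℕ≃ a)))))
    where
    lem : (+ a ℤ.* + suc n) ℤ.* ℤ.1ℤ ≡ + a ℤ.* (+ suc n ℤ.* ℤ.1ℤ)
    lem = ℤ.*-assoc (+ a) (+ suc n) ℤ.1ℤ

  ceil : ∀ q → ∃[ n ] q ≤ fromℕ n
  ceil q@(mkℚ (+ a) d _) = a , toℚᵘ-cancel-≤
    (ℚᵘ.≤-trans (ℚᵘ.*≤* lem) (ℚᵘ.≤-reflexive (ℚᵘ.≃-sym (fromℕ≃ a))))
    where
    lem : + a ℤ.* ℤ.1ℤ ℤ.≤ + a ℤ.* + suc d
    lem = ℤ.*-monoˡ-≤-nonNeg (+ a) (ℤ.+≤+ (ℕ.s≤s ℕ.z≤n))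
  ceil q@(mkℚ -[1+ a ] d _) = 0 , *≤* ℤ.-≤+

  fromℕ-mono : ∀ {m n} → m ℕ.≤ n → fromℕ m ≤ fromℕ n
  fromℕ-mono {_} {n} ℕ.z≤n = 0≤fromℕ n
  fromℕ-mono {suc m} {suc n} (ℕ.s≤s m≤n) =
    subst₂ _≤_ (sym (fromℕ-suc m)) (sym (fromℕ-suc n)) (+-monoʳ-≤ 1ℚ (fromℕ-mono m≤n))

  archimedean : ∀ a b → 0ℚ < a → ∃[ N ] ∀ {n} → N ℕ.≤ n → b ≤ fromℕ n * a
  archimedean a b 0<a with inv a 0<a
  ... | u , 0<u , ua≡1 with ceil (b * u)
  ... | N , bu≤N = N , λ N≤n → subst (_≤ _) lem (mulʳ (<⇒≤ 0<a) (≤-trans bu≤N (fromℕ-mono N≤n)))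
    where
    lem : b * u * a ≡ b
    lem = trans (*-assoc b u a) (trans (cong (b *_) ua≡1) (*-identityʳ b))

record ℝ : Set where
  constructor mkℝ
  field
    seq    : ℕ → ℚ
    cauchy : ∀ ε → 0ℚ < ε →
             ∃[ N ] ∀ {m n} → N ℕ.≤ m → N ℕ.≤ n → ∣ seq m - seq n ∣ ≤ ε

open ℝ public

infix 4 _≤ᴿ_ _<ᴿ_
infixl 7 _*ᴿ_

_≤ᴿ_ : ℝ → ℝ → Set
x ≤ᴿ y = ∀ ε → 0ℚ < ε → ∃[ N ] ∀ {n} → N ℕ.≤ n → seq x n ≤ seq y n + ε

_<ᴿ_ : ℝ → ℝ → Set
x <ᴿ y = ∃[ δ ] 0ℚ < δ × ∃[ N ] ∀ {n} → N ℕ.≤ n → seq x n + δ ≤ seq y n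

fromℚᴿ : ℚ → ℝ
fromℚᴿ q = mkℝ (λ _ → q) λ ε 0<ε →
  0 , λ _ _ → subst (λ d → ∣ d ∣ ≤ ε) (sym (+-inverseʳ q)) (<⇒≤ 0<ε)

fromℕᴿ : ℕ → ℝ
fromℕᴿ n = fromℚᴿ (fromℕ n)

0ᴿ 1ᴿ : ℝ
0ᴿ = fromℚᴿ 0ℚ
1ᴿ = fromℚᴿ 1ℚ

private
  bounded : ∀ x → ∃[ B ] 0ℚ < B × ∃[ N ] ∀ {n} → N ℕ.≤ n → ∣ seq x n ∣ ≤ B
  bounded x with cauchy x 1ℚ 0<1
  ... | N , h = 1ℚ + ∣ seq x N ∣ , 0<+ {1ℚ} {∣ seq x N ∣} 0<1 (0≤∣p∣ (seq x N)) , N , λ {n} N≤n →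
    ≤-trans (abs-from (seq x n) (seq x N))
      (subst (_≤ 1ℚ + ∣ seq x N ∣) (+-comm ∣ seq x n - seq x N ∣ ∣ seq x N ∣)
        (+-monoˡ-≤ ∣ seq x N ∣ (h N≤n ℕ.≤-refl)))

  *-est : ∀ {a b c d A B e} → 0ℚ ≤ e → ∣ a ∣ ≤ A → ∣ d ∣ ≤ B → ∣ b - d ∣ ≤ e → ∣ a - c ∣ ≤ e →
          ∣ a * b - c * d ∣ ≤ e * (A + B)
  *-est {a} {b} {c} {d} {A} {B} {e} 0≤e a≤A d≤B b-d≤e a-c≤e =
    ≤-trans (abs-tri (a * b) (a * d) (c * d)) (≤-trans (+-mono-≤ s₁ s₂) (≤-reflexive eq))
    where
    open +-*-Solver
    e₁ : a * (b - d) ≡ a * b - a * d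
    e₁ = solve 3 (λ a b d → a :* (b :- d) := a :* b :- a :* d) refl a b d
    e₂ : d * (a - c) ≡ a * d - c * d
    e₂ = solve 3 (λ a c d → d :* (a :- c) := a :* d :- c :* d) refl a c d
    s₁ : ∣ a * b - a * d ∣ ≤ A * e
    s₁ = subst (_≤ A * e) (trans (sym (∣p*q∣≡∣p∣*∣q∣ a (b - d))) (cong ∣_∣ e₁))
      (mul-mono (0≤∣p∣ a) 0≤e a≤A b-d≤e)
    s₂ : ∣ a * d - c * d ∣ ≤ B * e
    s₂ = subst (_≤ B * e) (trans (sym (∣p*q∣≡∣p∣*∣q∣ d (a - c))) (cong ∣_∣ e₂))
      (mul-mono (0≤∣p∣ d) 0≤e d≤B a-c≤e)
    eq : A * e + B * e ≡ e * (A + B)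
    eq = solve 3 (λ A B e → A :* e :+ B :* e := e :* (A :+ B)) refl A B e

  cancel-inv : ∀ {ε u a} → u * a ≡ 1ℚ → ε * u * a ≡ ε
  cancel-inv {ε} {u} {a} ua≡1 =
    trans (*-assoc ε u a) (trans (cong (ε *_) ua≡1) (*-identityʳ ε))

  EventuallyClose : (ℕ → ℚ) → ℚ → ℕ → Set
  EventuallyClose s ε N = ∀ {m n} → N ℕ.≤ m → N ℕ.≤ n → ∣ s m - s n ∣ ≤ ε

  EventuallyBounded : (ℕ → ℚ) → ℚ → ℕ → Set
  EventuallyBounded s B N = ∀ {n} → N ℕ.≤ n → ∣ s n ∣ ≤ B

  *-close : ∀ {s t A B e N₁ N₂ N₃ N₄} → 0ℚ ≤ e →
            EventuallyBounded s A N₁ → EventuallyBounded t B N₂ →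
            EventuallyClose s e N₃ → EventuallyClose t e N₄ →
            EventuallyClose (λ n → s n * t n) (e * (A + B)) (N₁ ℕ.+ N₂ ℕ.+ (N₃ ℕ.+ N₄))
  *-close {N₁ = N₁} {N₂} {N₃} {N₄} 0≤e hA hB hs ht p q =
    *-est 0≤e (hA (ℕ.m+n≤o⇒m≤o N₁ p₁₂)) (hB (ℕ.m+n≤o⇒n≤o N₁ q₁₂))
      (ht (ℕ.m+n≤o⇒n≤o N₃ p₃₄) (ℕ.m+n≤o⇒n≤o N₃ q₃₄))
      (hs (ℕ.m+n≤o⇒m≤o N₃ p₃₄) (ℕ.m+n≤o⇒m≤o N₃ q₃₄))
    where
    p₁₂ = ℕ.m+n≤o⇒m≤o (N₁ ℕ.+ N₂) p
    q₁₂ = ℕ.m+n≤o⇒m≤o (N₁ ℕ.+ N₂) q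
    p₃₄ = ℕ.m+n≤o⇒n≤o (N₁ ℕ.+ N₂) p
    q₃₄ = ℕ.m+n≤o⇒n≤o (N₁ ℕ.+ N₂) q

  *-cauchy : ∀ x y ε → 0ℚ < ε → ∃[ N ] EventuallyClose (λ n → seq x n * seq y n) ε N
  *-cauchy x y ε 0<ε = N₁ ℕ.+ N₂ ℕ.+ (N₃ ℕ.+ N₄) , λ p q →
    subst (∣ _ ∣ ≤_) (cancel-inv {ε} {u} u[A+B]≡1) (*-close (<⇒≤ 0<e) hA hB hx hy p q)
    where
    open Σ (bounded x) renaming (proj₁ to A; proj₂ to bx)
    open Σ (bounded y) renaming (proj₁ to B; proj₂ to by)
    N₁ = proj₁ (proj₂ bx)
    N₂ = proj₁ (proj₂ by)
    hA : EventuallyBounded (seq x) A N₁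
    hA = proj₂ (proj₂ bx)
    hB : EventuallyBounded (seq y) B N₂
    hB = proj₂ (proj₂ by)
    open Σ (inv (A + B) (0<+ (proj₁ bx) (<⇒≤ (proj₁ by)))) renaming (proj₁ to u; proj₂ to hu)
    u[A+B]≡1 = proj₂ hu
    0<e = 0<* 0<ε (proj₁ hu)
    open Σ (cauchy x (ε * u) 0<e) renaming (proj₁ to N₃; proj₂ to hx)
    open Σ (cauchy y (ε * u) 0<e) renaming (proj₁ to N₄; proj₂ to hy)

_*ᴿ_ : ℝ → ℝ → ℝ
x *ᴿ y = mkℝ (λ n → seq x n * seq y n) (*-cauchy x y)

private
  0<∣∣+1 : ∀ y → 0ℚ < ∣ y ∣ + 1ℚ
  0<∣∣+1 y = +-mono-≤-< (0≤∣p∣ y) 0<1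

-- The natural logarithm is computed from
--   log y = 2 artanh t = Σⱼ 2 / (2j + 1) · t²ʲ⁺¹,  t = (y - 1) / (y + 1),
-- which holds for all y > 0.  The absolute value in cayley only makes t total:
-- the rational approximations to a positive real are eventually positive.
cayley : ℚ → ℚ
cayley y = ((∣ y ∣ - 1ℚ) ÷ (∣ y ∣ + 1ℚ)) {{>-nonZero (0<∣∣+1 y)}}

logTerm : ℚ → ℕ → ℚ
logTerm t j = (+ 2 / suc (2 ℕ.* j)) * t ^ suc (2 ℕ.* j)

logSum : ℕ → ℚ → ℚ
logSum zero    t = 0ℚ
logSum (suc n) t = logSum n t + logTerm t n

private
  2ℚ : ℚ
  2ℚ = fromℕ 2

  0≤2 : 0ℚ ≤ 2ℚ
  0≤2 = 0≤fromℕ 2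

  0≤^ : ∀ {r} n → 0ℚ ≤ r → 0ℚ ≤ r ^ n
  0≤^ zero    0≤r = 0≤1
  0≤^ (suc n) 0≤r = 0≤* 0≤r (0≤^ n 0≤r)

  ^-anti : ∀ {r m n} → 0ℚ ≤ r → r ≤ 1ℚ → m ℕ.≤ n → r ^ n ≤ r ^ m
  ^-anti {r} {n = zero} 0≤r r≤1 ℕ.z≤n = ≤-refl
  ^-anti {r} {n = suc n} 0≤r r≤1 ℕ.z≤n =
    ≤-trans (mul-mono 0≤r 0≤1 r≤1 (^-anti {n = n} 0≤r r≤1 ℕ.z≤n)) (≤-reflexive (*-identityˡ 1ℚ))
  ^-anti 0≤r r≤1 (ℕ.s≤s m≤n) = mulˡ 0≤r (^-anti 0≤r r≤1 m≤n)

  ^-bound : ∀ {t r} n → 0ℚ ≤ r → ∣ t ∣ ≤ r → ∣ t ^ n ∣ ≤ r ^ n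
  ^-bound zero 0≤r t≤r = ≤-reflexive (0≤p⇒∣p∣≡p 0≤1)
  ^-bound {t} {r} (suc n) 0≤r t≤r =
    subst (_≤ r ^ suc n) (sym (∣p*q∣≡∣p∣*∣q∣ t (t ^ n)))
      (mul-mono (0≤∣p∣ t) (0≤^ n 0≤r) t≤r (^-bound n 0≤r t≤r))

  ^-lip : ∀ {t s r} n → 0ℚ ≤ r → ∣ t ∣ ≤ r → ∣ s ∣ ≤ r →
          ∣ t ^ suc n - s ^ suc n ∣ ≤ fromℕ (suc n) * r ^ n * ∣ t - s ∣
  ^-lip {t} {s} {r} zero 0≤r t≤r s≤r =
    ≤-reflexive (trans (cong₂ (λ a b → ∣ a - b ∣) (*-identityʳ t) (*-identityʳ s))
      (sym (trans (cong (_* ∣ t - s ∣) (*-identityˡ 1ℚ)) (*-identityˡ _))))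
  ^-lip {t} {s} {r} (suc n) 0≤r t≤r s≤r =
    ≤-trans (abs-tri (t * b) (t * d) (s * d))
      (≤-trans (+-mono-≤ s₁ s₂) (≤-reflexive eq))
    where
    open +-*-Solver
    b = t ^ suc n
    d = s ^ suc n
    D = ∣ t - s ∣
    e₁ : ∀ a b d → a * (b - d) ≡ a * b - a * d
    e₁ = solve 3 (λ a b d → a :* (b :- d) := a :* b :- a :* d) refl
    e₂ : ∀ a c d → d * (a - c) ≡ a * d - c * d
    e₂ = solve 3 (λ a c d → d :* (a :- c) := a :* d :- c :* d) refl
    s₁ : ∣ t * b - t * d ∣ ≤ r * (fromℕ (suc n) * r ^ n * D)
    s₁ = subst (_≤ r * (fromℕ (suc n) * r ^ n * D))
      (trans (sym (∣p*q∣≡∣p∣*∣q∣ t (b - d))) (cong ∣_∣ (e₁ t b d)))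
      (mul-mono (0≤∣p∣ t) (0≤* (0≤* (0≤fromℕ (suc n)) (0≤^ n 0≤r)) (0≤∣p∣ _)) t≤r (^-lip n 0≤r t≤r s≤r))
    s₂ : ∣ t * d - s * d ∣ ≤ r * r ^ n * D
    s₂ = subst (_≤ r * r ^ n * D)
      (trans (sym (∣p*q∣≡∣p∣*∣q∣ d (t - s))) (cong ∣_∣ (e₂ t s d)))
      (mulʳ (0≤∣p∣ (t - s)) (^-bound (suc n) 0≤r s≤r))
    e₃ : ∀ k r x D → r * (k * x * D) + r * x * D ≡ (1ℚ + k) * (r * x) * D
    e₃ k r x D = trans (solve 4 (λ k r x D → r :* (k :* x :* D) :+ r :* x :* D := (k :* (r :* x) :+ r :* x) :* D) refl k r x D)
      (cong (_* D) (trans (cong (λ z → k * (r * x) + z) (sym (*-identityˡ (r * x))))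
        (trans (+-comm (k * (r * x)) (1ℚ * (r * x))) (sym (*-distribʳ-+ (r * x) 1ℚ k)))))
    eq : r * (fromℕ (suc n) * r ^ n * D) + r * r ^ n * D ≡ fromℕ (suc (suc n)) * r ^ suc n * D
    eq = trans (e₃ (fromℕ (suc n)) r (r ^ n) D)
      (cong (λ k → k * r ^ suc n * D) (sym (fromℕ-suc (suc n))))

  coeff : ℕ → ℚ
  coeff j = + 2 / suc (2 ℕ.* j)

  0≤coeff : ∀ j → 0ℚ ≤ coeff j
  0≤coeff j = <⇒≤ (0</ 1 (2 ℕ.* j))

  coeff≤2 : ∀ j → coeff j ≤ 2ℚ
  coeff≤2 j = subst₂ _≤_ (*-identityʳ (coeff j)) (/-* 2 (2 ℕ.* j))
    (mulˡ (0≤coeff j) (fromℕ-mono {1} {suc (2 ℕ.* j)} (ℕ.s≤s ℕ.z≤n)))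

  ∣coeff*∣ : ∀ j a → ∣ coeff j * a ∣ ≡ coeff j * ∣ a ∣
  ∣coeff*∣ j a = trans (∣p*q∣≡∣p∣*∣q∣ (coeff j) a) (cong (_* ∣ a ∣) (0≤p⇒∣p∣≡p (0≤coeff j)))

  j≤2j : ∀ j → j ℕ.≤ 2 ℕ.* j
  j≤2j j = ℕ.m≤m+n j (j ℕ.+ 0)

  logTerm-bound : ∀ {t r} j → 0ℚ ≤ r → r ≤ 1ℚ → ∣ t ∣ ≤ r → ∣ logTerm t j ∣ ≤ 2ℚ * r ^ j
  logTerm-bound {t} {r} j 0≤r r≤1 t≤r =
    subst (_≤ 2ℚ * r ^ j) (sym (∣coeff*∣ j (t ^ suc (2 ℕ.* j))))
      (mul-mono (0≤coeff j) (0≤^ j 0≤r) (coeff≤2 j)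
        (≤-trans (^-bound (suc (2 ℕ.* j)) 0≤r t≤r) (^-anti 0≤r r≤1 (ℕ.m≤n⇒m≤1+n (j≤2j j)))))

  logTerm-lip : ∀ {t s r} j → 0ℚ ≤ r → r ≤ 1ℚ → ∣ t ∣ ≤ r → ∣ s ∣ ≤ r →
                ∣ logTerm t j - logTerm s j ∣ ≤ 2ℚ * r ^ j * ∣ t - s ∣
  logTerm-lip {t} {s} {r} j 0≤r r≤1 t≤r s≤r =
    subst (_≤ 2ℚ * r ^ j * D) (trans (sym (∣coeff*∣ j (t ^ i - s ^ i))) (cong ∣_∣ (e₁ (coeff j) (t ^ i) (s ^ i))))
      (≤-trans (mulˡ (0≤coeff j) (^-lip (2 ℕ.* j) 0≤r t≤r s≤r))
        (≤-trans (≤-reflexive eq)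
          (mulʳ (0≤∣p∣ (t - s)) (mulˡ 0≤2 (^-anti 0≤r r≤1 (j≤2j j))))))
    where
    open +-*-Solver
    i = suc (2 ℕ.* j)
    D = ∣ t - s ∣
    e₁ : ∀ a b d → a * (b - d) ≡ a * b - a * d
    e₁ = solve 3 (λ a b d → a :* (b :- d) := a :* b :- a :* d) refl
    e₂ : ∀ c k x D → c * (k * x * D) ≡ c * k * x * D
    e₂ = solve 4 (λ c k x D → c :* (k :* x :* D) := c :* k :* x :* D) refl
    eq : coeff j * (fromℕ i * r ^ (2 ℕ.* j) * D) ≡ 2ℚ * r ^ (2 ℕ.* j) * D
    eq = trans (e₂ (coeff j) (fromℕ i) (r ^ (2 ℕ.* j)) D)
      (cong (λ c → c * r ^ (2 ℕ.* j) * D) (/-* 2 (2 ℕ.* j)))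

  logSum-tail : ∀ {t r δ} → δ + r ≡ 1ℚ → 0ℚ ≤ δ → 0ℚ ≤ r → r ≤ 1ℚ → ∣ t ∣ ≤ r → ∀ n k →
                δ * ∣ logSum (k ℕ.+ n) t - logSum n t ∣ ≤ 2ℚ * (r ^ n - r ^ (k ℕ.+ n))
  logSum-tail {t} {r} {δ} δ+r≡1 0≤δ 0≤r r≤1 t≤r n zero = ≤-reflexive
    (trans (cong (λ d → δ * ∣ d ∣) (+-inverseʳ (logSum n t)))
      (trans (*-zeroʳ δ) (sym (trans (cong (2ℚ *_) (+-inverseʳ (r ^ n))) (*-zeroʳ 2ℚ)))))
  logSum-tail {t} {r} {δ} δ+r≡1 0≤δ 0≤r r≤1 t≤r n (suc k) =
    ≤-trans (mulˡ 0≤δ (subst (λ d → ∣ d ∣ ≤ ∣ S - S₀ ∣ + ∣ T ∣) (e₁ S T S₀) (∣p+q∣≤∣p∣+∣q∣ (S - S₀) T)))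
      (≤-trans (≤-reflexive (*-distribˡ-+ δ ∣ S - S₀ ∣ ∣ T ∣))
      (≤-trans (+-mono-≤ (logSum-tail δ+r≡1 0≤δ 0≤r r≤1 t≤r n k) (mulˡ 0≤δ (logTerm-bound (k ℕ.+ n) 0≤r r≤1 t≤r)))
      (≤-reflexive eq)))
    where
    open +-*-Solver
    S = logSum (k ℕ.+ n) t
    S₀ = logSum n t
    T = logTerm t (k ℕ.+ n)
    e₁ : ∀ S T S₀ → S - S₀ + T ≡ S + T - S₀
    e₁ = solve 3 (λ S T S₀ → S :- S₀ :+ T := S :+ T :- S₀) refl
    e₂ : ∀ δ r c x y → c * (x - (δ + r) * y) + δ * (c * y) ≡ c * (x - r * y)
    e₂ = solve 5 (λ δ r c x y → c :* (x :- (δ :+ r) :* y) :+ δ :* (c :* y) := c :* (x :- r :* y)) refl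
    eq : 2ℚ * (r ^ n - r ^ (k ℕ.+ n)) + δ * (2ℚ * r ^ (k ℕ.+ n)) ≡ 2ℚ * (r ^ n - r ^ suc (k ℕ.+ n))
    eq = trans
      (cong (λ z → 2ℚ * (r ^ n - z) + δ * (2ℚ * r ^ (k ℕ.+ n)))
        (trans (sym (*-identityˡ (r ^ (k ℕ.+ n)))) (cong (_* r ^ (k ℕ.+ n)) (sym δ+r≡1))))
      (e₂ δ r 2ℚ (r ^ n) (r ^ (k ℕ.+ n)))

  logSum-lip : ∀ {t s r δ} → δ + r ≡ 1ℚ → 0ℚ ≤ δ → 0ℚ ≤ r → r ≤ 1ℚ → ∣ t ∣ ≤ r → ∣ s ∣ ≤ r → ∀ n →
               δ * ∣ logSum n t - logSum n s ∣ ≤ 2ℚ * ∣ t - s ∣ * (1ℚ - r ^ n)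
  logSum-lip {t} {s} {r} {δ} δ+r≡1 0≤δ 0≤r r≤1 t≤r s≤r zero = ≤-reflexive
    (trans (*-zeroʳ δ) (sym (*-zeroʳ (2ℚ * ∣ t - s ∣))))
  logSum-lip {t} {s} {r} {δ} δ+r≡1 0≤δ 0≤r r≤1 t≤r s≤r (suc n) =
    ≤-trans (mulˡ 0≤δ (subst (λ d → ∣ d ∣ ≤ ∣ S - S′ ∣ + ∣ T - T′ ∣) (e₁ S S′ T T′) (∣p+q∣≤∣p∣+∣q∣ (S - S′) (T - T′))))
      (≤-trans (≤-reflexive (*-distribˡ-+ δ ∣ S - S′ ∣ ∣ T - T′ ∣))
      (≤-trans (+-mono-≤ (logSum-lip δ+r≡1 0≤δ 0≤r r≤1 t≤r s≤r n) (mulˡ 0≤δ (logTerm-lip n 0≤r r≤1 t≤r s≤r)))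
      (≤-reflexive eq)))
    where
    open +-*-Solver
    S = logSum n t
    S′ = logSum n s
    T = logTerm t n
    T′ = logTerm s n
    D = ∣ t - s ∣
    e₁ : ∀ S S′ T T′ → S - S′ + (T - T′) ≡ S + T - (S′ + T′)
    e₁ = solve 4 (λ S S′ T T′ → S :- S′ :+ (T :- T′) := S :+ T :- (S′ :+ T′)) refl
    e₂ : ∀ δ r c D y u → c * D * (u - (δ + r) * y) + δ * (c * y * D) ≡ c * D * (u - r * y)
    e₂ = solve 6 (λ δ r c D y u → c :* D :* (u :- (δ :+ r) :* y) :+ δ :* (c :* y :* D) := c :* D :* (u :- r :* y)) refl
    eq : 2ℚ * D * (1ℚ - r ^ n) + δ * (2ℚ * r ^ n * D) ≡ 2ℚ * D * (1ℚ - r ^ suc n)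
    eq = trans
      (cong (λ z → 2ℚ * D * (1ℚ - z) + δ * (2ℚ * r ^ n * D))
        (trans (sym (*-identityˡ (r ^ n))) (cong (_* r ^ n) (sym δ+r≡1))))
      (e₂ δ r 2ℚ D (r ^ n) 1ℚ)

  ≤-minus : ∀ {a b} → 0ℚ ≤ b → a - b ≤ a
  ≤-minus {a} {b} 0≤b = subst (a - b ≤_) (+-identityʳ a) (+-monoʳ-≤ a (neg-antimono-≤ 0≤b))

  logSum-close : ∀ {t s r δ} → δ + r ≡ 1ℚ → 0ℚ ≤ δ → 0ℚ ≤ r → r ≤ 1ℚ → ∣ t ∣ ≤ r → ∣ s ∣ ≤ r → ∀ {n m} → n ℕ.≤ m →
                 δ * ∣ logSum m t - logSum n s ∣ ≤ 2ℚ * r ^ n + 2ℚ * ∣ t - s ∣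
  logSum-close {t} {s} {r} {δ} δ+r≡1 0≤δ 0≤r r≤1 t≤r s≤r {n} {m} n≤m =
    ≤-trans (mulˡ 0≤δ (abs-tri (logSum m t) (logSum n t) (logSum n s)))
      (≤-trans (≤-reflexive (*-distribˡ-+ δ _ _))
        (+-mono-≤ tail lip))
    where
    tail : δ * ∣ logSum m t - logSum n t ∣ ≤ 2ℚ * r ^ n
    tail = ≤-trans
      (subst (λ i → δ * ∣ logSum i t - logSum n t ∣ ≤ 2ℚ * (r ^ n - r ^ i)) (ℕ.m∸n+n≡m n≤m)
        (logSum-tail δ+r≡1 0≤δ 0≤r r≤1 t≤r n (m ℕ.∸ n)))
      (mulˡ 0≤2 (≤-minus {r ^ n} {r ^ m} (0≤^ m 0≤r)))
    lip : δ * ∣ logSum n t - logSum n s ∣ ≤ 2ℚ * ∣ t - s ∣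
    lip = ≤-trans (logSum-lip δ+r≡1 0≤δ 0≤r r≤1 t≤r s≤r n)
      (≤-trans (mulˡ (0≤* 0≤2 (0≤∣p∣ (t - s))) (≤-minus {1ℚ} {r ^ n} (0≤^ n 0≤r)))
        (≤-reflexive (*-identityʳ _)))

  bernoulli : ∀ {r δ} → δ + r ≡ 1ℚ → 0ℚ ≤ r → 0ℚ ≤ δ → ∀ n → r ^ n * (1ℚ + fromℕ n * δ) ≤ 1ℚ
  bernoulli {r} {δ} δ+r≡1 0≤r 0≤δ zero = ≤-reflexive
    (trans (*-identityˡ _) (trans (cong (λ z → 1ℚ + z) (*-zeroˡ δ)) (+-identityʳ 1ℚ)))
  bernoulli {r} {δ} δ+r≡1 0≤r 0≤δ (suc n) =
    ≤-trans (0≤-⇒≤ (subst (0ℚ ≤_) (sym eq) (0≤* (0≤^ n 0≤r) (0≤* (0≤* 0≤δ 0≤δ) 0≤k))))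
      (bernoulli δ+r≡1 0≤r 0≤δ n)
    where
    open +-*-Solver
    k = 1ℚ + fromℕ n
    0≤k : 0ℚ ≤ k
    0≤k = 0≤+ 0≤1 (0≤fromℕ n)
    e : ∀ δ f x → x * (1ℚ + f * δ) - (1ℚ - δ) * x * (1ℚ + (1ℚ + f) * δ) ≡ x * (δ * δ * (1ℚ + f))
    e = solve 3 (λ δ f x → x :* (con 1ℚ :+ f :* δ) :- (con 1ℚ :- δ) :* x :* (con 1ℚ :+ (con 1ℚ :+ f) :* δ)
                 := x :* (δ :* δ :* (con 1ℚ :+ f))) refl
    e′ : ∀ r δ → r ≡ δ + r - δ
    e′ = solve 2 (λ r δ → r := δ :+ r :- δ) refl
    r≡ : r ≡ 1ℚ - δ
    r≡ = trans (e′ r δ) (cong (_- δ) δ+r≡1)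
    eq : r ^ n * (1ℚ + fromℕ n * δ) - r ^ suc n * (1ℚ + fromℕ (suc n) * δ) ≡ r ^ n * (δ * δ * k)
    eq = trans (cong₂ (λ a b → r ^ n * (1ℚ + fromℕ n * δ) - a * r ^ n * (1ℚ + b * δ)) r≡ (fromℕ-suc n))
      (e δ (fromℕ n) (r ^ n))

  ^-small : ∀ {r δ η} → δ + r ≡ 1ℚ → 0ℚ ≤ r → 0ℚ < δ → 0ℚ < η → ∃[ N ] ∀ {n} → N ℕ.≤ n → r ^ n ≤ η
  ^-small {r} {δ} {η} δ+r≡1 0≤r 0<δ 0<η =
    proj₁ arch , λ {n} N≤n →
      ≤-trans (≤-reflexive (sym (*-identityʳ (r ^ n))))
      (≤-trans (mulˡ (0≤^ n 0≤r) (proj₂ arch N≤n))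
      (≤-trans (≤-reflexive (e (r ^ n) (fromℕ n) δ η))
      (≤-trans (mulˡ (<⇒≤ 0<η) (≤-trans (mulˡ (0≤^ n 0≤r) (x≤1+x (fromℕ n * δ))) (bernoulli δ+r≡1 0≤r (<⇒≤ 0<δ) n)))
        (≤-reflexive (*-identityʳ η)))))
    where
    open +-*-Solver
    arch = archimedean (δ * η) 1ℚ (0<* 0<δ 0<η)
    e : ∀ x k δ η → x * (k * (δ * η)) ≡ η * (x * (k * δ))
    e = solve 4 (λ x k δ η → x :* (k :* (δ :* η)) := η :* (x :* (k :* δ))) refl
    x≤1+x : ∀ x → x ≤ 1ℚ + x
    x≤1+x x = subst (_≤ 1ℚ + x) (+-identityˡ x) (+-monoˡ-≤ x 0≤1)

  -- With u = 1 / (∣y∣ + 1) one has cayley y = 1 - 2u.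
  u : ℚ → ℚ
  u y = (1/ (∣ y ∣ + 1ℚ)) {{>-nonZero (0<∣∣+1 y)}}

  u*≡1 : ∀ y → u y * (∣ y ∣ + 1ℚ) ≡ 1ℚ
  u*≡1 y = *-inverseˡ (∣ y ∣ + 1ℚ) {{>-nonZero (0<∣∣+1 y)}}

  0<u : ∀ y → 0ℚ < u y
  0<u y = positive⁻¹ (u y) {{1/pos⇒pos (∣ y ∣ + 1ℚ) {{positive (0<∣∣+1 y)}}}}

  recip-≤1 : ∀ {w a} → 0ℚ ≤ w → 0ℚ ≤ a → w * (a + 1ℚ) ≡ 1ℚ → w ≤ 1ℚ
  recip-≤1 {w} {a} 0≤w 0≤a eq = subst₂ _≤_ (*-identityʳ w) eq
    (mulˡ 0≤w (subst (_≤ a + 1ℚ) (+-identityˡ 1ℚ) (+-monoˡ-≤ 1ℚ 0≤a)))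

  recip-anti : ∀ {w u a b} → 0ℚ ≤ w → 0ℚ ≤ u → a ≤ b → u * (a + 1ℚ) ≡ 1ℚ → w * (b + 1ℚ) ≡ 1ℚ → w ≤ u
  recip-anti {w} {u} {a} {b} 0≤w 0≤u a≤b ua wb = subst₂ _≤_
    (trans (cong (w *_) ua) (*-identityʳ w))
    (trans (e w u (b + 1ℚ)) (trans (cong (u *_) wb) (*-identityʳ u)))
    (mulˡ 0≤w (mulˡ 0≤u (+-monoˡ-≤ 1ℚ a≤b)))
    where
    open +-*-Solver
    e : ∀ w u b → w * (u * b) ≡ u * (w * b)
    e = solve 3 (λ w u b → w :* (u :* b) := u :* (w :* b)) refl

  cayley≡ : ∀ y → cayley y ≡ 1ℚ - (1ℚ + 1ℚ) * u y
  cayley≡ y = trans (e ∣ y ∣ (u y) 1ℚ) (cong (_- (1ℚ + 1ℚ) * u y) (u*≡1 y))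
    where
    open +-*-Solver
    e : ∀ a u o → (a - o) * u ≡ u * (a + o) - (o + o) * u
    e = solve 3 (λ a u o → (a :- o) :* u := u :* (a :+ o) :- (o :+ o) :* u) refl

  cayley-bound′ : ∀ {a u w c} → 0ℚ ≤ c → c ≤ 1ℚ → c ≤ a → 0ℚ ≤ w → w ≤ u → u * (a + 1ℚ) ≡ 1ℚ →
                  ∣ 1ℚ - (1ℚ + 1ℚ) * u ∣ ≤ 1ℚ - c * w
  cayley-bound′ {a} {u} {w} {c} 0≤c c≤1 c≤a 0≤w w≤u ua = abs≤
    (+-monoʳ-≤ 1ℚ (neg-antimono-≤ cw≤2u))
    (0≤-⇒≤ (subst (0ℚ ≤_) (sym eq) (0≤+ (≤⇒0≤- cw≤ua) (0≤* 0≤u 0≤a))))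
    where
    open +-*-Solver
    0≤u : 0ℚ ≤ u
    0≤u = ≤-trans 0≤w w≤u
    0≤a : 0ℚ ≤ a
    0≤a = ≤-trans 0≤c c≤a
    cw≤ua : c * w ≤ u * a
    cw≤ua = subst (_≤ u * a) (*-comm w c) (mul-mono 0≤w 0≤a w≤u c≤a)
    cw≤2u : c * w ≤ (1ℚ + 1ℚ) * u
    cw≤2u = mul-mono 0≤c 0≤u (≤-trans c≤1 (≤-+ʳ {1ℚ} {1ℚ} 0≤1)) w≤u
    e : ∀ u a x o → u * (a + o) - x - - (u * (a + o) - (o + o) * u) ≡ u * a - x + u * a
    e = solve 4 (λ u a x o → u :* (a :+ o) :- x :- :- (u :* (a :+ o) :- (o :+ o) :* u) := u :* a :- x :+ u :* a) refl
    eq : 1ℚ - c * w - - (1ℚ - (1ℚ + 1ℚ) * u) ≡ u * a - c * w + u * a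
    eq = trans (cong (λ z → z - c * w - - (z - (1ℚ + 1ℚ) * u)) (sym ua)) (e u a (c * w) 1ℚ)

  cayley-bound : ∀ {y B c w} → 0ℚ ≤ c → c ≤ 1ℚ → c ≤ y → ∣ y ∣ ≤ B → 0ℚ ≤ w → w * (B + 1ℚ) ≡ 1ℚ →
                 ∣ cayley y ∣ ≤ 1ℚ - c * w
  cayley-bound {y} {c = c} {w} 0≤c c≤1 c≤y y≤B 0≤w wB =
    subst (λ t → ∣ t ∣ ≤ 1ℚ - c * w) (sym (cayley≡ y))
      (cayley-bound′ 0≤c c≤1 (≤-trans c≤y (≤abs y)) 0≤w
        (recip-anti 0≤w (<⇒≤ (0<u y)) y≤B (u*≡1 y) wB) (u*≡1 y))

  cayley-lip : ∀ y z → ∣ cayley y - cayley z ∣ ≤ (1ℚ + 1ℚ) * ∣ y - z ∣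
  cayley-lip y z = subst (_≤ (1ℚ + 1ℚ) * ∣ y - z ∣) (sym eq)
    (mulˡ {1ℚ + 1ℚ} (0≤+ {1ℚ} {1ℚ} 0≤1 0≤1)
      (subst (u y * u z * ∣ ∣ y ∣ - ∣ z ∣ ∣ ≤_) (*-identityˡ ∣ y - z ∣)
        (mul-mono 0≤uv (0≤∣p∣ (y - z)) uv≤1 (abs-abs y z))))
    where
    open +-*-Solver
    0≤uv : 0ℚ ≤ u y * u z
    0≤uv = 0≤* (<⇒≤ (0<u y)) (<⇒≤ (0<u z))
    u≤1 : ∀ y → u y ≤ 1ℚ
    u≤1 y = recip-≤1 (<⇒≤ (0<u y)) (0≤∣p∣ y) (u*≡1 y)
    uv≤1 : u y * u z ≤ 1ℚ
    uv≤1 = ≤-trans (mul-mono (<⇒≤ (0<u y)) 0≤1 (u≤1 y) (u≤1 z)) (≤-reflexive (*-identityˡ 1ℚ))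
    e₁ : ∀ o u v → o - (o + o) * u - (o - (o + o) * v) ≡ (o + o) * (v * o - u * o) + ((o + o) * (u * o - u) - (o + o) * (v * o - v))
    e₁ = solve 3 (λ o u v → o :- (o :+ o) :* u :- (o :- (o :+ o) :* v) := (o :+ o) :* (v :* o :- u :* o) :+ ((o :+ o) :* (u :* o :- u) :- (o :+ o) :* (v :* o :- v))) refl
    e₂ : ∀ o u v a b → v * (u * (a + o)) - u * (v * (b + o)) ≡ u * v * (a - b)
    e₂ = solve 5 (λ o u v a b → v :* (u :* (a :+ o)) :- u :* (v :* (b :+ o)) := u :* v :* (a :- b)) refl
    e₃ : ∀ o t u v → o - t * u - (o - t * v) ≡ t * (v - u)
    e₃ = solve 4 (λ o t u v → o :- t :* u :- (o :- t :* v) := t :* (v :- u)) refl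
    v-u : u z - u y ≡ u y * u z * (∣ y ∣ - ∣ z ∣)
    v-u = trans (cong₂ _-_ (sym (trans (cong (u z *_) (u*≡1 y)) (*-identityʳ (u z))))
                           (sym (trans (cong (u y *_) (u*≡1 z)) (*-identityʳ (u y)))))
      (e₂ 1ℚ (u y) (u z) ∣ y ∣ ∣ z ∣)
    diff : cayley y - cayley z ≡ (1ℚ + 1ℚ) * (u y * u z * (∣ y ∣ - ∣ z ∣))
    diff = trans (cong₂ _-_ (cayley≡ y) (cayley≡ z))
      (trans (e₃ 1ℚ (1ℚ + 1ℚ) (u y) (u z)) (cong ((1ℚ + 1ℚ) *_) v-u))
    eq : ∣ cayley y - cayley z ∣ ≡ (1ℚ + 1ℚ) * (u y * u z * ∣ ∣ y ∣ - ∣ z ∣ ∣)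
    eq = trans (cong ∣_∣ diff) (trans (∣p*q∣≡∣p∣*∣q∣ (1ℚ + 1ℚ) (u y * u z * (∣ y ∣ - ∣ z ∣)))
      (cong ((1ℚ + 1ℚ) *_) (trans (∣p*q∣≡∣p∣*∣q∣ (u y * u z) (∣ y ∣ - ∣ z ∣))
        (cong (_* ∣ ∣ y ∣ - ∣ z ∣ ∣) (0≤p⇒∣p∣≡p 0≤uv)))))

  module LogCauchy (x : ℝ) (0<x : 0ᴿ <ᴿ x) (ε : ℚ) (0<ε : 0ℚ < ε) where
    open +-*-Solver

    q c B w δ r i κ : ℚ
    N₁ N₂ N₃ N₄ : ℕ

    q = proj₁ 0<x
    N₁ = proj₁ (proj₂ (proj₂ 0<x))
    c = q ⊓ 1ℚ
    B = proj₁ (bounded x)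
    N₂ = proj₁ (proj₂ (proj₂ (bounded x)))

    0<B : 0ℚ < B
    0<B = proj₁ (proj₂ (bounded x))

    invB : ∃[ w ] 0ℚ < w × w * (B + 1ℚ) ≡ 1ℚ
    invB = inv (B + 1ℚ) (0<+ 0<B 0≤1)
    w = proj₁ invB

    0<w : 0ℚ < w
    0<w = proj₁ (proj₂ invB)

    0<c : 0ℚ < c
    0<c = subst (_< c) (⊓-idem 0ℚ) (⊓-mono-< (proj₁ (proj₂ 0<x)) 0<1)
      where
      ⊓-mono-< : ∀ {a b d e} → a < d → b < e → a ⊓ b < d ⊓ e
      ⊓-mono-< {a} {b} {d} {e} a<d b<e with ≤-total d e
      ... | inj₁ d≤e = subst (a ⊓ b <_) (sym (p≤q⇒p⊓q≡p d≤e)) (≤-<-trans (p⊓q≤p a b) a<d)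
      ... | inj₂ e≤d = subst (a ⊓ b <_) (sym (p≥q⇒p⊓q≡q e≤d)) (≤-<-trans (p⊓q≤q a b) b<e)

    c≤1 : c ≤ 1ℚ
    c≤1 = p⊓q≤q q 1ℚ

    δ = c * w
    r = 1ℚ - δ

    0<δ : 0ℚ < δ
    0<δ = 0<* 0<c 0<w

    δ≤1 : δ ≤ 1ℚ
    δ≤1 = ≤-trans (mul-mono (<⇒≤ 0<c) 0≤1 c≤1 (recip-≤1 (<⇒≤ 0<w) (<⇒≤ 0<B) (proj₂ (proj₂ invB))))
      (≤-reflexive (*-identityˡ 1ℚ))

    0≤r : 0ℚ ≤ r
    0≤r = ≤⇒0≤- δ≤1

    r≤1 : r ≤ 1ℚ
    r≤1 = ≤-minus {1ℚ} (<⇒≤ 0<δ)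

    δ+r≡1 : δ + r ≡ 1ℚ
    δ+r≡1 = e δ 1ℚ
      where
      e : ∀ δ o → δ + (o - δ) ≡ o
      e = solve 2 (λ δ o → δ :+ (o :- δ) := o) refl

    invK : ∃[ i ] 0ℚ < i × i * (2ℚ + 2ℚ * (1ℚ + 1ℚ)) ≡ 1ℚ
    invK = inv (2ℚ + 2ℚ * (1ℚ + 1ℚ)) (0<+ (0</ 1 0) (0≤* {2ℚ} {1ℚ + 1ℚ} 0≤2 (0≤+ {1ℚ} {1ℚ} 0≤1 0≤1)))
    i = proj₁ invK
    κ = δ * ε * i

    0<κ : 0ℚ < κ
    0<κ = 0<* (0<* 0<δ 0<ε) (proj₁ (proj₂ invK))

    small : ∃[ N ] ∀ {n} → N ℕ.≤ n → r ^ n ≤ κ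
    small = ^-small δ+r≡1 0≤r 0<δ 0<κ
    N₃ = proj₁ small

    close : ∃[ N ] EventuallyClose (seq x) κ N
    close = cauchy x κ 0<κ
    N₄ = proj₁ close

    N : ℕ
    N = N₁ ℕ.+ N₂ ℕ.+ (N₃ ℕ.+ N₄)

    t : ℕ → ℚ
    t n = cayley (seq x n)

    t≤r : ∀ {n} → N ℕ.≤ n → ∣ t n ∣ ≤ r
    t≤r {n} N≤n = cayley-bound (<⇒≤ 0<c) c≤1 c≤x (proj₂ (proj₂ (proj₂ (bounded x))) (ℕ.m+n≤o⇒n≤o N₁ N₁₂≤n))
      (<⇒≤ 0<w) (proj₂ (proj₂ invB))
      where
      N₁₂≤n = ℕ.m+n≤o⇒m≤o (N₁ ℕ.+ N₂) N≤n
      c≤x : c ≤ seq x n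
      c≤x = ≤-trans (p⊓q≤p q 1ℚ) (subst (_≤ seq x n) (+-identityˡ q)
        (proj₂ (proj₂ (proj₂ 0<x)) (ℕ.m+n≤o⇒m≤o N₁ N₁₂≤n)))

    bound : ∀ {m n} → N ℕ.≤ m → N ℕ.≤ n → n ℕ.≤ m → ∣ logSum m (t m) - logSum n (t n) ∣ ≤ ε
    bound {m} {n} N≤m N≤n n≤m = *-cancelˡ-≤-pos δ {{positive 0<δ}}
      (≤-trans (logSum-close δ+r≡1 (<⇒≤ 0<δ) 0≤r r≤1 (t≤r N≤m) (t≤r N≤n) n≤m)
      (≤-trans (+-mono-≤ (mulˡ 0≤2 (proj₂ small (ℕ.m+n≤o⇒m≤o N₃ N₃₄≤n)))
                 (mulˡ 0≤2 (≤-trans (cayley-lip (seq x m) (seq x n))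
                   (mulˡ {1ℚ + 1ℚ} (0≤+ {1ℚ} {1ℚ} 0≤1 0≤1) (proj₂ close (ℕ.m+n≤o⇒n≤o N₃ N₃₄≤m) (ℕ.m+n≤o⇒n≤o N₃ N₃₄≤n))))))
      (≤-reflexive eq)))
      where
      N₃₄≤m = ℕ.m+n≤o⇒n≤o (N₁ ℕ.+ N₂) N≤m
      N₃₄≤n = ℕ.m+n≤o⇒n≤o (N₁ ℕ.+ N₂) N≤n
      e : ∀ d o k → d * k + d * ((o + o) * k) ≡ k * (d + d * (o + o))
      e = solve 3 (λ d o k → d :* k :+ d :* ((o :+ o) :* k) := k :* (d :+ d :* (o :+ o))) refl
      eq : 2ℚ * κ + 2ℚ * ((1ℚ + 1ℚ) * κ) ≡ δ * ε
      eq = trans (e 2ℚ 1ℚ κ) (cancel-inv {δ * ε} {i} (proj₂ (proj₂ invK)))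

    bound′ : EventuallyClose (λ n → logSum n (t n)) ε N
    bound′ {m} {n} N≤m N≤n = [ bound N≤m N≤n , flipped ]′ (ℕ.≤-total n m)
      where
      flipped : m ℕ.≤ n → ∣ logSum m (t m) - logSum n (t n) ∣ ≤ ε
      flipped m≤n = subst (_≤ ε) (abs-sym (logSum n (t n)) (logSum m (t m))) (bound N≤n N≤m m≤n)

-- The n-th approximation to log x is the n-th partial sum of the series at the
-- n-th approximation to x.
log : (x : ℝ) → 0ᴿ <ᴿ x → ℝ
log x 0<x = mkℝ (λ n → logSum n (cayley (seq x n))) λ ε 0<ε →
  LogCauchy.N x 0<x ε 0<ε , LogCauchy.bound′ x 0<x ε 0<ε

1<⇒0< : ∀ x → 1ᴿ <ᴿ x → 0ᴿ <ᴿ x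
1<⇒0< x (δ , 0<δ , N , h) = δ , 0<δ , N , λ N≤n → ≤-trans (+-monoˡ-≤ δ 0≤1) (h N≤n)

private
  0≤logTerm : ∀ {t} j → 0ℚ ≤ t → 0ℚ ≤ logTerm t j
  0≤logTerm j 0≤t = 0≤* (0≤coeff j) (0≤^ (suc (2 ℕ.* j)) 0≤t)

  logSum-lower : ∀ {t} n → 0ℚ ≤ t → t ≤ logSum (suc n) t
  logSum-lower {t} zero 0≤t = subst (t ≤_) (sym (+-identityˡ (2ℚ * (t * 1ℚ))))
    (subst₂ _≤_ (*-identityˡ t) (cong (2ℚ *_) (sym (*-identityʳ t)))
      (mulʳ 0≤t (fromℕ-mono {1} {2} (ℕ.s≤s ℕ.z≤n))))
  logSum-lower {t} (suc n) 0≤t =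
    ≤-trans (logSum-lower n 0≤t) (≤-+ʳ (0≤logTerm (suc n) 0≤t))

  cayley-lower : ∀ {y δ B w} → 0ℚ ≤ δ → 1ℚ + δ ≤ y → ∣ y ∣ ≤ B → 0ℚ ≤ w → w * (B + 1ℚ) ≡ 1ℚ →
                 δ * w ≤ cayley y
  cayley-lower {y} {δ} 0≤δ 1+δ≤y y≤B 0≤w wB =
    mul-mono 0≤δ (<⇒≤ (0<u y))
      (subst (_≤ ∣ y ∣ - 1ℚ) (e 1ℚ δ) (+-monoˡ-≤ (- 1ℚ) (≤-trans 1+δ≤y (≤abs y))))
      (recip-anti 0≤w (<⇒≤ (0<u y)) y≤B (u*≡1 y) wB)
    where
    open +-*-Solver
    e : ∀ o δ → o + δ - o ≡ δ
    e = solve 2 (λ o δ → o :+ δ :- o := δ) refl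

0<log : ∀ x (1<x : 1ᴿ <ᴿ x) → 0ᴿ <ᴿ log x (1<⇒0< x 1<x)
0<log x (δ , 0<δ , N₁ , h) =
  δ * w , 0<δw , suc (N₁ ℕ.+ N₂) , λ { {suc n} (ℕ.s≤s N≤n) → lower n N≤n }
  where
  B = proj₁ (bounded x)
  N₂ = proj₁ (proj₂ (proj₂ (bounded x)))
  invB : ∃[ w ] 0ℚ < w × w * (B + 1ℚ) ≡ 1ℚ
  invB = inv (B + 1ℚ) (0<+ (proj₁ (proj₂ (bounded x))) 0≤1)
  w = proj₁ invB
  0<δw : 0ℚ < δ * w
  0<δw = 0<* 0<δ (proj₁ (proj₂ invB))
  lower : ∀ n → N₁ ℕ.+ N₂ ℕ.≤ n → 0ℚ + δ * w ≤ logSum (suc n) (cayley (seq x (suc n)))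
  lower n N≤n = ≤-trans (≤-reflexive (+-identityˡ (δ * w)))
    (≤-trans δw≤t (logSum-lower n (≤-trans (<⇒≤ 0<δw) δw≤t)))
    where
    N≤1+n = ℕ.m≤n⇒m≤1+n N≤n
    δw≤t : δ * w ≤ cayley (seq x (suc n))
    δw≤t = cayley-lower (<⇒≤ 0<δ) (h (ℕ.m+n≤o⇒m≤o N₁ N≤1+n))
      (proj₂ (proj₂ (proj₂ (bounded x))) (ℕ.m+n≤o⇒n≤o N₁ N≤1+n))
      (<⇒≤ (proj₁ (proj₂ invB))) (proj₂ (proj₂ invB))

1<fromℕᴿ : ∀ {n} → 2 ℕ.≤ n → 1ᴿ <ᴿ fromℕᴿ n
1<fromℕᴿ 2≤n = 1ℚ , 0<1 , 0 , λ _ → fromℕ-mono 2≤n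

indicator : ∀ {N} → Fin N → Fin N → ℚ
indicator x y = if does (x Fin.≟ y) then 1ℚ else 0ℚ

-- A transition matrix together with a stationary distribution of full support,
-- so that the ratios Pⁿ(x,y) / π(y) make sense.
record MarkovChain (N : ℕ) : Set where
  field
    P            : Fin N → Fin N → ℚ
    P-nonNeg     : ∀ x y → NonNegative (P x y)
    P-rowSum     : ∀ x → ∑[ y < N ] P x y ≡ 1ℚ
    π            : Fin N → ℚ
    π-pos        : ∀ y → Positive (π y)
    π-sum        : ∑[ y < N ] π y ≡ 1ℚ
    π-stationary : ∀ y → ∑[ x < N ] (π x * P x y) ≡ π y

  P^ : ℕ → Fin N → Fin N → ℚ
  P^ zero    x y = indicator x y
  P^ (suc n) x y = ∑[ z < N ] (P x z * P^ n z y)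

  SeparationWithin : ℚ → ℕ → Set
  SeparationWithin ε n = ∀ x y → 1ℚ - (P^ n x y ÷ π y) {{pos⇒nonZero (π y) {{π-pos y}}}} ≤ ε

  -- τ = τₛ(ε); the minimum is taken over all n ≥ 0, with P⁰ the identity.
  IsSeparationMixingTime : ℚ → ℕ → Set
  IsSeparationMixingTime ε τ =
    SeparationWithin ε τ × (∀ n → SeparationWithin ε n → τ ℕ.≤ n)

open MarkovChain public using (IsSeparationMixingTime)

private
  sum-indicator : ∀ {N} (x : Fin N) → ∑[ y < N ] indicator x y ≡ 1ℚ
  sum-indicator {suc N} zero    = trans (cong (λ z → 1ℚ + z) (sum-replicate-zero N)) (+-identityʳ 1ℚ)
  sum-indicator {suc N} (suc x) = trans (+-identityˡ _) (sum-indicator x)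

  sum-const : ∀ n c → ∑[ _ < n ] c ≡ fromℕ n * c
  sum-const zero    c = sym (*-zeroˡ c)
  sum-const (suc n) c = trans (cong₂ _+_ (sym (*-identityˡ c)) (sum-const n c))
    (trans (sym (*-distribʳ-+ c 1ℚ (fromℕ n))) (cong (_* c) (sym (fromℕ-suc n))))

  Inverse : ∀ {N} → (Fin N → Fin N) → Set
  Inverse {N} f = Σ (Fin N → Fin N) λ g → (∀ x → g (f x) ≡ x) × (∀ y → f (g y) ≡ y)

  sum-preimage : ∀ {N} (f : Fin N → Fin N) → Inverse f → ∀ y → ∑[ x < N ] indicator (f x) y ≡ 1ℚ
  sum-preimage f (g , gf , fg) y = trans (sum-cong-≗ flip) (sum-indicator (g y))
    where
    flip : ∀ x → indicator (f x) y ≡ indicator (g y) x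
    flip x = cong (λ b → if b then 1ℚ else 0ℚ) (does-⇔
      (mk⇔ (λ eq → trans (cong g (sym eq)) (gf x)) (λ eq → trans (cong f (sym eq)) (fg y)))
      (f x Fin.≟ y) (g y Fin.≟ x))

  thirds : ∀ {N} (a b c : Fin N → ℚ) →
           ∑[ i < N ] a i ≡ 1ℚ → ∑[ i < N ] b i ≡ 1ℚ → ∑[ i < N ] c i ≡ 1ℚ →
           ∑[ i < N ] (+ 1 / 3 * (a i + b i + c i)) ≡ 1ℚ
  thirds a b c Σa Σb Σc = trans (sym (*-distribˡ-sum (+ 1 / 3) (λ i → a i + b i + c i)))
    (cong (λ z → + 1 / 3 * z) (trans (∑-distrib-+ (λ i → a i + b i) c)
      (cong₂ _+_ (trans (∑-distrib-+ a b) (cong₂ _+_ Σa Σb)) Σc)))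

  indicator-nonNeg : ∀ {N} (x y : Fin N) → 0ℚ ≤ indicator x y
  indicator-nonNeg x y with x Fin.≟ y
  ... | yes _ = 0≤1
  ... | no  _ = ≤-refl

module _ {p : ℕ} .{{_ : ℕ.NonZero p}} where

  shift : ℕ → Fin p → Fin p
  shift c i = (toℕ i ℕ.+ c) ℕ.mod p

  double : Fin p → Fin p
  double i = (2 ℕ.* toℕ i) ℕ.mod p

  -- The three moves contribute separately, so coinciding targets add up.
  pollardStep : Fin p → Fin p → Fin p → ℚ
  pollardStep k i j =
    + 1 / 3 * (indicator (shift 1 i) j + indicator (shift (toℕ k) i) j + indicator (double i) j)

private
  module _ {p : ℕ} .{{_ : ℕ.NonZero p}} where

    mod-inverse : ∀ (F G : ℕ → ℕ) → (∀ n → G (F n ℕ.% p) ℕ.% p ≡ n ℕ.% p) →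
                  ∀ (i : Fin p) → G (toℕ (F (toℕ i) ℕ.mod p)) ℕ.mod p ≡ i
    mod-inverse F G GF i = Fin.toℕ-injective (trans (Fin.toℕ-fromℕ< _)
      (trans (cong (λ n → G n ℕ.% p) (Fin.toℕ-fromℕ< _))
        (trans (GF (toℕ i)) (ℕ.m<n⇒m%n≡m (Fin.toℕ<n i)))))

    shift-% : ∀ a b → a ℕ.+ b ≡ p → ∀ n → ((n ℕ.+ a) ℕ.% p ℕ.+ b) ℕ.% p ≡ n ℕ.% p
    shift-% a b a+b≡p n = begin
      ((n ℕ.+ a) ℕ.% p ℕ.+ b) ℕ.% p             ≡⟨ ℕ.%-distribˡ-+ ((n ℕ.+ a) ℕ.% p) b p ⟩
      ((n ℕ.+ a) ℕ.% p ℕ.% p ℕ.+ b ℕ.% p) ℕ.% p ≡⟨ cong (λ z → (z ℕ.+ b ℕ.% p) ℕ.% p) (ℕ.m%n%n≡m%n (n ℕ.+ a) p) ⟩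
      ((n ℕ.+ a) ℕ.% p ℕ.+ b ℕ.% p) ℕ.% p       ≡⟨ ℕ.%-distribˡ-+ (n ℕ.+ a) b p ⟨
      (n ℕ.+ a ℕ.+ b) ℕ.% p                     ≡⟨ cong (ℕ._% p) (trans (ℕ.+-assoc n a b) (cong (n ℕ.+_) a+b≡p)) ⟩
      (n ℕ.+ p) ℕ.% p                           ≡⟨ ℕ.[m+n]%n≡m%n n p ⟩
      n ℕ.% p                                   ∎
      where open ≡-Reasoning

    shift-inverse : ∀ c → c ℕ.≤ p → Inverse (shift c)
    shift-inverse c c≤p = shift (p ℕ.∸ c) ,
      mod-inverse (ℕ._+ c) (ℕ._+ (p ℕ.∸ c)) (shift-% c (p ℕ.∸ c) (ℕ.m+[n∸m]≡n c≤p)) ,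
      mod-inverse (ℕ._+ (p ℕ.∸ c)) (ℕ._+ c) (shift-% (p ℕ.∸ c) c (ℕ.m∸n+n≡m c≤p))

    mul-% : ∀ a b → b ℕ.* a ≡ suc p → ∀ n → (b ℕ.* ((a ℕ.* n) ℕ.% p)) ℕ.% p ≡ n ℕ.% p
    mul-% a b ba≡1+p n = begin
      (b ℕ.* ((a ℕ.* n) ℕ.% p)) ℕ.% p                 ≡⟨ ℕ.%-distribˡ-* b ((a ℕ.* n) ℕ.% p) p ⟩
      (b ℕ.% p ℕ.* ((a ℕ.* n) ℕ.% p ℕ.% p)) ℕ.% p     ≡⟨ cong (λ z → (b ℕ.% p ℕ.* z) ℕ.% p) (ℕ.m%n%n≡m%n (a ℕ.* n) p) ⟩
      (b ℕ.% p ℕ.* ((a ℕ.* n) ℕ.% p)) ℕ.% p           ≡⟨ ℕ.%-distribˡ-* b (a ℕ.* n) p ⟨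
      (b ℕ.* (a ℕ.* n)) ℕ.% p                         ≡⟨ cong (ℕ._% p) (trans (sym (ℕ.*-assoc b a n)) (cong (ℕ._* n) ba≡1+p)) ⟩
      (n ℕ.+ p ℕ.* n) ℕ.% p                           ≡⟨ cong (λ z → (n ℕ.+ z) ℕ.% p) (ℕ.*-comm p n) ⟩
      (n ℕ.+ n ℕ.* p) ℕ.% p                           ≡⟨ ℕ.[m+kn]%n≡m%n n n p ⟩
      n ℕ.% p                                         ∎
      where open ≡-Reasoning

    double-inverse : p ℕ.% 2 ≡ 1 → Inverse double
    double-inverse odd = (λ i → (h ℕ.* toℕ i) ℕ.mod p) ,
      mod-inverse (2 ℕ.*_) (h ℕ.*_) (mul-% 2 h h2≡1+p) ,
      mod-inverse (h ℕ.*_) (2 ℕ.*_) (mul-% h 2 (trans (ℕ.*-comm 2 h) h2≡1+p))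
      where
      h = suc (p ℕ./ 2)
      h2≡1+p : h ℕ.* 2 ≡ suc p
      h2≡1+p = cong suc (sym (trans (ℕ.m≡m%n+[m/n]*n p 2) (cong (ℕ._+ p ℕ./ 2 ℕ.* 2) odd)))

    uniform-sum : ∑[ _ < p ] (+ 1 / p) ≡ 1ℚ
    uniform-sum = trans (sum-const p (+ 1 / p)) (trans (*-comm (fromℕ p) (+ 1 / p)) (lem p))
      where
      lem : ∀ n .{{_ : ℕ.NonZero n}} → + 1 / n * fromℕ n ≡ 1ℚ
      lem (suc n) = /-* 1 n

    pollard-nonNeg : ∀ k i j → NonNegative (pollardStep k i j)
    pollard-nonNeg k i j = nonNegative (0≤* {+ 1 / 3} (<⇒≤ (0</ 0 2))
      (0≤+ (0≤+ (indicator-nonNeg (shift 1 i) j) (indicator-nonNeg (shift (toℕ k) i) j))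
        (indicator-nonNeg (double i) j)))

    pollard-rowSum : ∀ k i → ∑[ j < p ] pollardStep k i j ≡ 1ℚ
    pollard-rowSum k i =
      thirds (indicator (shift 1 i)) (indicator (shift (toℕ k) i)) (indicator (double i))
        (sum-indicator (shift 1 i)) (sum-indicator (shift (toℕ k) i)) (sum-indicator (double i))

    pollard-columnSum : p ℕ.% 2 ≡ 1 → ∀ k j → ∑[ i < p ] pollardStep k i j ≡ 1ℚ
    pollard-columnSum odd k j =
      thirds (λ i → indicator (shift 1 i) j) (λ i → indicator (shift (toℕ k) i) j) (λ i → indicator (double i) j)
        (sum-preimage (shift 1) (shift-inverse 1 (ℕ.>-nonZero⁻¹ p)) j)
        (sum-preimage (shift (toℕ k)) (shift-inverse (toℕ k) (ℕ.<⇒≤ (Fin.toℕ<n k))) j)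
        (sum-preimage double (double-inverse odd) j)

    pollard-stationary : p ℕ.% 2 ≡ 1 → ∀ k j → ∑[ i < p ] (+ 1 / p * pollardStep k i j) ≡ + 1 / p
    pollard-stationary odd k j = trans (sym (*-distribˡ-sum (+ 1 / p) (λ i → pollardStep k i j)))
      (trans (cong (λ z → + 1 / p * z) (pollard-columnSum odd k j)) (*-identityʳ (+ 1 / p)))

pollardRho : ∀ {p} → p ℕ.% 2 ≡ 1 → Fin p → MarkovChain p
pollardRho {p} odd k = record
  { P            = pollardStep k
  ; P-nonNeg     = pollard-nonNeg k
  ; P-rowSum     = pollard-rowSum k
  ; π            = λ _ → + 1 / p
  ; π-pos        = λ _ → normalize-pos 1 p
  ; π-sum        = uniform-sum {p}
  ; π-stationary = pollard-stationary odd k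
  }
  where
  instance
    p≢0 : ℕ.NonZero p
    p≢0 = Fin.nonZeroIndex k

mersenne : ℕ → ℕ
mersenne m = 2 ℕ.^ m ℕ.∸ 1

2≤mersenne : ∀ {m} → 2 ℕ.≤ m → 2 ℕ.≤ mersenne m
2≤mersenne 2≤m = ℕ.≤-trans (ℕ.n≤1+n 2) (ℕ.∸-monoˡ-≤ 1 (ℕ.^-monoʳ-≤ 2 2≤m))

mersenne-odd : ∀ {m} → 2 ℕ.≤ m → mersenne m ℕ.% 2 ≡ 1
mersenne-odd {suc m} _ = lem (2 ℕ.^ m) {{ℕ.m^n≢0 2 m}}
  where
  lem : ∀ n .{{_ : ℕ.NonZero n}} → (2 ℕ.* n ℕ.∸ 1) ℕ.% 2 ≡ 1
  lem (suc r) = trans (cong (ℕ._% 2) (trans (ℕ.+-suc r (r ℕ.+ 0)) (cong suc (ℕ.*-comm 2 r))))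
    (ℕ.[m+kn]%n≡m%n 1 r 2)

{-# OPTIONS --safe #-}

-- Two consecutive steps "+1, then double" and "double, then +1" lead from x to 2x + 2
-- and 2x + 1.  They are equally likely, so each such pair supplies an independent fair
-- bit, whatever k is; all other randomness may be fixed.  The final position is then a
-- constant plus Σ 2ʲ εⱼ, where j counts the doublings after the pair, and j only matters
-- mod m because 2^m ≡ 1 mod 2^m - 1.  Once every residue class of positions has received
-- a bit, each point is hit with conditional probability at least 2^-m = (1/p)·p/(p + 1).
-- That some class is still empty after O(m log m) steps is excluded by a union bound:
-- a supermartingale shows that each class survives n pairs with probability
-- O((1 - c/m)^n).
--
-- With t = 1 - 2/(y + 1), the first y/8 or so powers in the series for log y are at least
-- 1/2, so that the series dominates a harmonic sum; this gives log p ≥ m/8 and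
-- log log p ≥ (⌊log₂ m⌋ + 4)/200.
module Submission where

open import Defs

-- Averages over fair bits, and their rotation under doubling.

module PathCounting where

  open import Data.Nat.Base
  open import Data.Nat.Properties
  open import Data.Nat.DivMod
  open import Data.Nat.Tactic.RingSolver using (solve-∀)
  open import Data.Fin.Base using (Fin; toℕ)
  import Data.Fin.Properties as Fin
  open import Data.Bool.Base using (Bool; true; false; if_then_else_)
  open import Data.List.Base using (List; []; _∷_; _∷ʳ_; length; replicate)
  open import Data.List.Properties using (length-++; length-replicate)
  open import Data.Product.Base using (∃-syntax; _×_; _,_; proj₁; proj₂)
  open import Data.Sum.Base using (_⊎_; inj₁; inj₂)
  open import Algebra.Properties.CommutativeSemigroup +-commutativeSemigroup
    using () renaming (interchange to +-interchange; xy∙z≈xz∙y to +-swapʳ)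
  open import Relation.Nullary.Decidable using (does; yes; no; dec-true)
  open import Relation.Binary.PropositionalEquality

  -- smear u bs x is 2^|bs| times the average of u (x + Σ εᵢ 2ⁱ) over independent
  -- fair bits εᵢ at the positions marked true; the head of bs has the highest weight.
  smear : (ℕ → ℕ) → List Bool → ℕ → ℕ
  smear u []           x = u x
  smear u (true  ∷ bs) x = smear u bs x + smear u bs (x + 2 ^ length bs)
  smear u (false ∷ bs) x = smear u bs x + smear u bs x

  smear-cong : ∀ {u v} → (∀ z → u z ≡ v z) → ∀ bs x → smear u bs x ≡ smear v bs x
  smear-cong e []           x = e x
  smear-cong e (true  ∷ bs) x = cong₂ _+_ (smear-cong e bs x) (smear-cong e bs _)
  smear-cong e (false ∷ bs) x = cong₂ _+_ (smear-cong e bs x) (smear-cong e bs x)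

  smear-+ : ∀ u v bs x → smear (λ z → u z + v z) bs x ≡ smear u bs x + smear v bs x
  smear-+ u v []           x = refl
  smear-+ u v (true  ∷ bs) x =
    trans (cong₂ _+_ (smear-+ u v bs x) (smear-+ u v bs _)) (+-interchange (smear u bs x) _ _ _)
  smear-+ u v (false ∷ bs) x =
    trans (cong₂ _+_ (smear-+ u v bs x) (smear-+ u v bs x)) (+-interchange (smear u bs x) _ _ _)

  smear-shift : ∀ u c bs x → smear (λ z → u (z + c)) bs x ≡ smear u bs (x + c)
  smear-shift u c []           x = refl
  smear-shift u c (true  ∷ bs) x = cong₂ _+_ (smear-shift u c bs x)
    (trans (smear-shift u c bs _) (cong (smear u bs) (+-swapʳ x _ c)))
  smear-shift u c (false ∷ bs) x = cong₂ _+_ (smear-shift u c bs x) (smear-shift u c bs x)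

  length-∷ʳ : ∀ (bs : List Bool) b → length (bs ∷ʳ b) ≡ suc (length bs)
  length-∷ʳ bs b = trans (length-++ bs) (+-comm (length bs) 1)

  -- A new last place doubles all earlier weights. At the even point `2 * x` the earlier bits can
  -- therefore act on `x` before the doubling, and only `b` acts after it.
  smear-∷ʳ : ∀ u bs b x → smear u (bs ∷ʳ b) (2 * x) ≡ smear (λ z → smear u (b ∷ []) (2 * z)) bs x
  smear-∷ʳ u []           b x = refl
  smear-∷ʳ u (true  ∷ bs) b x = cong₂ _+_ (smear-∷ʳ u bs b x) (trans
    (cong (smear u (bs ∷ʳ b)) (trans (cong (λ l → 2 * x + 2 ^ l) (length-∷ʳ bs b))
      (sym (*-distribˡ-+ 2 x (2 ^ length bs)))))
    (smear-∷ʳ u bs b (x + 2 ^ length bs)))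
  smear-∷ʳ u (false ∷ bs) b x = cong₂ _+_ (smear-∷ʳ u bs b x) (smear-∷ʳ u bs b x)

  Periodic : ℕ → (ℕ → ℕ) → Set
  Periodic p u = ∀ x → u (x + p) ≡ u x

  periodic-shift : ∀ {p u} c → Periodic p u → Periodic p (λ z → u (z + c))
  periodic-shift {p} {u} c per x = trans (cong u (+-swapʳ x p c)) (per (x + c))

  periodic-double : ∀ {p u} → Periodic p u → Periodic p (λ z → u (2 * z))
  periodic-double {p} {u} per x = trans (cong u (lem x p)) (trans (per (2 * x + p)) (per (2 * x)))
    where
    lem : ∀ x p → 2 * (x + p) ≡ 2 * x + p + p
    lem = solve-∀

  -- The head has weight 2^(m-1), which doubling turns into 2^m = p + 1, that is into 1 by
  -- periodicity: the head re-enters at the last place. A `false` head is a bare factor 2 and can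
  -- stand at either end.
  smear-rotate : ∀ {p u} b bs x → Periodic p u → 2 ^ length (b ∷ bs) ≡ suc p →
                 smear (λ z → u (2 * z)) (b ∷ bs) x ≡ smear u (bs ∷ʳ b) (2 * x)
  smear-rotate {p} {u} true bs x per e = begin
    smear (λ z → u (2 * z)) bs x + smear (λ z → u (2 * z)) bs (x + 2 ^ length bs)
      ≡⟨ cong (smear (λ z → u (2 * z)) bs x +_) (smear-shift (λ z → u (2 * z)) (2 ^ length bs) bs x) ⟨
    smear (λ z → u (2 * z)) bs x + smear (λ z → u (2 * (z + 2 ^ length bs))) bs x
      ≡⟨ smear-+ (λ z → u (2 * z)) (λ z → u (2 * (z + 2 ^ length bs))) bs x ⟨
    smear (λ z → u (2 * z) + u (2 * (z + 2 ^ length bs))) bs x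
      ≡⟨ smear-cong (λ z → cong (u (2 * z) +_) (wrap z)) bs x ⟩
    smear (λ z → u (2 * z) + u (2 * z + 1)) bs x
      ≡⟨ smear-∷ʳ u bs true x ⟨
    smear u (bs ∷ʳ true) (2 * x) ∎
    where
    open ≡-Reasoning
    wrap : ∀ z → u (2 * (z + 2 ^ length bs)) ≡ u (2 * z + 1)
    wrap z = trans (cong u (trans (*-distribˡ-+ 2 z _)
      (trans (cong (2 * z +_) e) (sym (+-assoc (2 * z) 1 p))))) (per (2 * z + 1))
  smear-rotate {p} {u} false bs x per e =
    trans (sym (smear-+ v v bs x)) (sym (smear-∷ʳ u bs false x))
    where
    v = λ z → u (2 * z)

  -- The transition operator on path counts, and the insertion of a fair bit.

  move : ℕ → (ℕ → ℕ) → ℕ → ℕ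
  move k u x = u (x + 1) + u (x + k) + u (2 * x)

  smear-+₃ : ∀ u v w bs x →
    smear (λ z → u z + v z + w z) bs x ≡ smear u bs x + smear v bs x + smear w bs x
  smear-+₃ u v w bs x = trans (smear-+ (λ z → u z + v z) w bs x)
    (cong (_+ smear w bs x) (smear-+ u v bs x))

  smear-move : ∀ k u bs x →
    smear (move k u) bs x ≡ smear u bs (x + 1) + smear u bs (x + k) + smear (λ z → u (2 * z)) bs x
  smear-move k u bs x = trans (smear-+₃ (λ z → u (z + 1)) (λ z → u (z + k)) _ bs x)
    (cong (_+ smear (λ z → u (2 * z)) bs x) (cong₂ _+_ (smear-shift u 1 bs x) (smear-shift u k bs x)))

  periodic-move : ∀ {p u} k → Periodic p u → Periodic p (move k u)
  periodic-move k per x = cong₂ _+_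
    (cong₂ _+_ (periodic-shift 1 per x) (periodic-shift k per x)) (periodic-double per x)

  -- Step +1 followed by doubling gives 2x + 2, doubling followed by +1 gives 2x + 1:
  -- together they supply a fair bit of weight 1, the last place of the rotated list.
  smear-insert : ∀ {p u} b bs x → Periodic p u → 2 ^ length (b ∷ bs) ≡ suc p →
    ∃[ y ] ∃[ y′ ] smear (λ z → u (2 * z)) (b ∷ bs) (x + 1) + smear (λ z → u (2 * z + 1)) (b ∷ bs) x
             ≡ smear u (bs ∷ʳ true) y + smear u (bs ∷ʳ true) y′
  -- A `true` head rotates into the last place by itself: the pair gains nothing new and its two
  -- words stay separate.
  smear-insert {p} {u} true bs x per e = 2 * (x + 1) , 2 * x + 1 ,
    cong₂ _+_ (smear-rotate {u = u} true bs (x + 1) per e)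
      (trans (smear-rotate true bs x (periodic-shift {u = u} 1 per) e) (smear-shift u 1 (bs ∷ʳ true) (2 * x)))
  -- The empty head doubles both terms, so `E` and `O` occur twice each. Every sum `E + O` fills the
  -- empty place, its two values being 2x + 1 and 2x + 2.
  smear-insert {p} {u} false bs x per e = 2 * x + 1 , 2 * x + 1 ,
    trans (+-interchange E E O O) (cong₂ _+_ both both)
    where
    E = smear (λ z → u (2 * z)) bs (x + 1)
    O = smear (λ z → u (2 * z + 1)) bs x
    lem : ∀ z → 2 * (z + 1) ≡ 2 * z + 1 + 1
    lem = solve-∀
    both : E + O ≡ smear u (bs ∷ʳ true) (2 * x + 1)
    both = begin
      E + O ≡⟨ +-comm E O ⟩
      O + E ≡⟨ cong (O +_) (smear-shift (λ z → u (2 * z)) 1 bs x) ⟨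
      O + smear (λ z → u (2 * (z + 1))) bs x ≡⟨ smear-+ (λ z → u (2 * z + 1)) _ bs x ⟨
      smear (λ z → u (2 * z + 1) + u (2 * (z + 1))) bs x
        ≡⟨ smear-cong (λ z → cong (λ y → u (2 * z + 1) + u y) (lem z)) bs x ⟩
      smear (λ z → u (2 * z + 1) + u (2 * z + 1 + 1)) bs x ≡⟨ smear-∷ʳ (λ z → u (z + 1)) bs true x ⟨
      smear (λ z → u (z + 1)) (bs ∷ʳ true) (2 * x) ≡⟨ smear-shift u 1 (bs ∷ʳ true) (2 * x) ⟩
      smear u (bs ∷ʳ true) (2 * x + 1) ∎
      where open ≡-Reasoning

  -- The supermartingale for places without a bit.

  -- cost f bs is the union bound: the sum of f over the positions without a bit.
  missing : Bool → ℕ → ℕ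
  missing b w = if b then 0 else w

  cost : (ℕ → ℕ) → List Bool → ℕ
  cost f []       = 0
  cost f (b ∷ bs) = missing b (f 0) + cost (λ i → f (suc i)) bs

  cost-∷ʳ : ∀ f bs b → cost f (bs ∷ʳ b) ≡ cost f bs + missing b (f (length bs))
  cost-∷ʳ f []       b = +-identityʳ _
  cost-∷ʳ f (a ∷ bs) b = trans (cong (missing a (f 0) +_) (cost-∷ʳ (λ i → f (suc i)) bs b))
    (sym (+-assoc (missing a (f 0)) _ _))

  -- weight m i / 8m is a supermartingale (at rate 1 − 1/(40m + 1) per two steps) that
  -- dominates the probability that the position i doublings away gets no bit.  The dip
  -- at i = 0 pays for two consecutive doublings jumping over the position.
  weight : ℕ → ℕ → ℕ
  weight m zero    = 8 * m
  weight m (suc i) = 9 * m + 3 * suc i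

  weight≤ : ∀ m i → weight m i ≤ 9 * m + 3 * i
  weight≤ m zero    = ≤-trans (m≤n+m (8 * m) m) (m≤m+n (9 * m) 0)
  weight≤ m (suc i) = ≤-refl

  8m≤weight : ∀ m i → 8 * m ≤ weight m i
  8m≤weight m zero    = ≤-refl
  8m≤weight m (suc i) = ≤-trans (m≤n+m (8 * m) m) (m≤m+n (9 * m) _)

  rate : ℕ → ℕ
  rate m = 40 * m

  -- With K = `rate m` this is 4c + y ≤ 9 (1 - 1/(K + 1)) c, cleared of denominators. Of the nine
  -- two-step words, four never double and keep the cost c; y is the total cost after the other
  -- five.
  record Decays (m y c : ℕ) : Set where
    constructor decays
    field
      holds : suc (rate m) * (4 * c + y) ≤ 9 * rate m * c

  -- Polynomial inequalities below are certified by naming the slack `d`, which leaves an identity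
  -- for the ring solver.
  ≤-by : ∀ {a b} d → a + d ≡ b → a ≤ b
  ≤-by d refl = m≤m+n _ d

  decays-+ : ∀ {m y c y′ c′} → Decays m y c → Decays m y′ c′ → Decays m (y + y′) (c + c′)
  decays-+ {m} {y} {c} {y′} {c′} (decays d) (decays d′) = decays
    (subst₂ _≤_ (l (suc (rate m)) y c y′ c′) (sym (*-distribˡ-+ (9 * rate m) c c′)) (+-mono-≤ d d′))
    where
    l : ∀ k y c y′ c′ → k * (4 * c + y) + k * (4 * c′ + y′) ≡ k * (4 * (c + c′) + (y + y′))
    l = solve-∀

  decays-mono : ∀ {m y y′ c} → y′ ≤ y → Decays m y c → Decays m y′ c
  decays-mono {m} {c = c} y′≤y (decays d) =
    decays (≤-trans (*-monoʳ-≤ (suc (rate m)) (+-monoʳ-≤ (4 * c) y′≤y)) d)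

  decays-0 : ∀ m → Decays m 0 0
  decays-0 m = decays (subst (_≤ 9 * rate m * 0) (sym (*-zeroʳ (rate m))) z≤n)

  decays-missing : ∀ m b {y c} → Decays m y c → Decays m (missing b y) (missing b c)
  decays-missing m true  d = decays-0 m
  decays-missing m false d = d

  -- A place is given by its index `i` and the number `j` of places after it, so that the length is
  -- a sum and the polynomial identities contain no subtraction.
  decays-cost : ∀ m {f g : ℕ → ℕ} bs → (∀ i j → suc (i + j) ≡ length bs → Decays m (f i) (g i)) →
                Decays m (cost f bs) (cost g bs)
  decays-cost m []       h = decays-0 m
  decays-cost m (b ∷ bs) h = decays-+ (decays-missing m b (h 0 (length bs) refl))
    (decays-cost m bs λ i j e → h (suc i) j (cong suc e))

  -- The head goes to one of the last two places, of weight at most 12m, in three words, and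
  -- receives a bit in two: 4 * 8m + 3 * 12m = 68m against 9 * 8m = 72m.
  decays-0th : ∀ l → Decays (2 + l) (2 * weight (2 + l) (1 + l) + weight (2 + l) l) (weight (2 + l) 0)
  decays-0th l = decays-mono (+-monoʳ-≤ (2 * weight (2 + l) (1 + l)) (weight≤ (2 + l) l))
    (decays (≤-by (160 * (2 + l) * (2 + l) + 412 * (2 + l) + 12) (lem l)))
    where
    lem : ∀ l → suc (40 * (2 + l)) * (4 * (8 * (2 + l)) + (2 * (9 * (2 + l) + 3 * (1 + l)) + (9 * (2 + l) + 3 * l)))
                  + (160 * (2 + l) * (2 + l) + 412 * (2 + l) + 12)
                ≡ 9 * (40 * (2 + l)) * (8 * (2 + l))
    lem = solve-∀

  -- In four words this place becomes the head; in one it jumps past the head to the end, unfilled.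
  -- Up to constants the total is 36m + 32m + 12m = 80m against 81m.
  decays-1st : ∀ l → Decays (2 + l) (4 * weight (2 + l) 0 + weight (2 + l) (1 + l)) (weight (2 + l) 1)
  decays-1st l = decays (≤-by (40 * (2 + l) * (2 + l) + 600 * (2 + l) + 40 * l + 71) (lem l))
    where
    lem : ∀ l → suc (40 * (2 + l)) * (4 * (9 * (2 + l) + 3) + (4 * (8 * (2 + l)) + (9 * (2 + l) + 3 * (1 + l))))
                  + (40 * (2 + l) * (2 + l) + 600 * (2 + l) + 40 * l + 71)
                ≡ 9 * (40 * (2 + l)) * (9 * (2 + l) + 3)
    lem = solve-∀

  -- Four words bring the place nearer by one and one word by two, so the slope 3 gains 3 * (4 + 2)
  -- = 18 over the nine words. Against weights of at most 12m this yields a relative decay of order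
  -- 1/m.
  decays-later : ∀ i j → let m = 3 + (i + j) in
                 Decays m (4 * weight m (1 + i) + weight m i) (weight m (2 + i))
  decays-later i j = decays-mono (+-monoʳ-≤ (4 * weight m (1 + i)) (weight≤ m i))
    (decays (≤-by (612 * i + 639 * j + 1881) (lem i j)))
    where
    m = 3 + (i + j)
    lem : ∀ i j → suc (40 * (3 + (i + j))) * (4 * (9 * (3 + (i + j)) + 3 * (2 + i))
                      + (4 * (9 * (3 + (i + j)) + 3 * (1 + i)) + (9 * (3 + (i + j)) + 3 * i)))
                    + (612 * i + 639 * j + 1881)
                  ≡ 9 * (40 * (3 + (i + j))) * (9 * (3 + (i + j)) + 3 * (2 + i))
    lem = solve-∀

  -- The five words with a doubling: one doubling and a step +k in either order, two doublings, and
  -- the two words that together supply a bit.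
  rotated : (ℕ → ℕ) → Bool → Bool → List Bool → ℕ
  rotated f b b′ bs = 2 * cost f (b′ ∷ (bs ∷ʳ b)) + cost f ((bs ∷ʳ b) ∷ʳ b′) + 2 * cost f (b′ ∷ (bs ∷ʳ true))

  cost-linear : ∀ f g bs → cost (λ i → 4 * f i + g i) bs ≡ 4 * cost f bs + cost g bs
  cost-linear f g []           = refl
  cost-linear f g (true  ∷ bs) = cost-linear _ _ bs
  cost-linear f g (false ∷ bs) = trans (cong (4 * f 0 + g 0 +_) (cost-linear _ _ bs))
    (lem (f 0) (g 0) (cost (λ i → f (suc i)) bs) (cost (λ i → g (suc i)) bs))
    where
    lem : ∀ a b c d → 4 * a + b + (4 * c + d) ≡ 4 * (a + c) + (b + d)
    lem = solve-∀

  -- Exchanges two sums: each place collects the values of `f` at its destinations under the five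
  -- words, so that decay can be checked place by place.
  rotated≡ : ∀ f b b′ bs → let l = length bs in rotated f b b′ bs ≡
    missing b (2 * f (1 + l) + f l) + (missing b′ (4 * f 0 + f (1 + l))
      + cost (λ i → 4 * f (1 + i) + f i) bs)
  rotated≡ f b b′ bs = begin
    rotated f b b′ bs
      ≡⟨ cong₂ _+_ (cong₂ _+_ (cong (λ c → 2 * (m₀ + c)) (cost-∷ʳ (λ i → f (suc i)) bs b))
           (trans (cost-∷ʳ f (bs ∷ʳ b) b′) (cong₂ _+_ (cost-∷ʳ f bs b)
              (cong (λ l → missing b′ (f l)) (length-∷ʳ bs b)))))
         (cong (λ c → 2 * (m₀ + c)) (cost-∷ʳ (λ i → f (suc i)) bs true)) ⟩
    2 * (m₀ + (C + missing b (f (1 + l)))) + (D + missing b (f l) + missing b′ (f (1 + l))) + 2 * (m₀ + (C + 0))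
      ≡⟨ split b b′ (f 0) (f (1 + l)) (f l) C D ⟩
    missing b (2 * f (1 + l) + f l) + (missing b′ (4 * f 0 + f (1 + l)) + (4 * C + D))
      ≡⟨ cong (λ c → missing b (2 * f (1 + l) + f l) + (missing b′ (4 * f 0 + f (1 + l)) + c)) (cost-linear (λ i → f (suc i)) f bs) ⟨
    _ ∎
    where
    open ≡-Reasoning
    l = length bs
    m₀ = missing b′ (f 0)
    C = cost (λ i → f (suc i)) bs
    D = cost f bs
    split : ∀ b b′ x y z C D → 2 * (missing b′ x + (C + missing b y)) + (D + missing b z + missing b′ y)
              + 2 * (missing b′ x + (C + 0))
            ≡ missing b (2 * y + z) + (missing b′ (4 * x + y) + (4 * C + D))
    split true  true  x y z = solve-∀
    split true  false x y z = lem x y z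
      where
      lem : ∀ x y z C D → 2 * (x + (C + 0)) + (D + 0 + y) + 2 * (x + (C + 0)) ≡ 0 + ((4 * x + y) + (4 * C + D))
      lem = solve-∀
    split false true  x y z = lem x y z
      where
      lem : ∀ x y z C D → 2 * (0 + (C + y)) + (D + z + 0) + 2 * (0 + (C + 0)) ≡ (2 * y + z) + (0 + (4 * C + D))
      lem = solve-∀
    split false false x y z = lem x y z
      where
      lem : ∀ x y z C D → 2 * (x + (C + y)) + (D + z + y) + 2 * (x + (C + 0)) ≡ (2 * y + z) + ((4 * x + y) + (4 * C + D))
      lem = solve-∀

  decays-rotated : ∀ b b′ bs → let m = 2 + length bs in
                   Decays m (rotated (weight m) b b′ bs) (cost (weight m) (b ∷ b′ ∷ bs))
  decays-rotated b b′ bs = subst (λ y → Decays m y (cost (weight m) (b ∷ b′ ∷ bs)))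
    (sym (rotated≡ (weight m) b b′ bs))
    (decays-+ (decays-missing m b (decays-0th l)) (decays-+ (decays-missing m b′ (decays-1st l))
      (decays-cost m bs later)))
    where
    l = length bs
    m = 2 + l
    later : ∀ i j → suc (i + j) ≡ l → Decays m (4 * weight m (1 + i) + weight m i) (weight m (2 + i))
    later i j e = subst
      (λ l → Decays (2 + l) (4 * weight (2 + l) (1 + i) + weight (2 + l) i) (weight (2 + l) (2 + i)))
      e (decays-later i j)

  -- Induction on the number of steps.

  record Bound (a w c s d : ℕ) : Set where
    constructor bound
    field
      holds : a ≤ w * s + c * d

  infixl 6 _⊕_
  _⊕_ : ∀ {a a′ w c s s′ d d′} → Bound a w c s d → Bound a′ w c s′ d′ → Bound (a + a′) w c (s + s′) (d + d′)
  _⊕_ {w = w} {c} {s} {s′} {d} {d′} (bound h) (bound h′) =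
    bound (≤-trans (+-mono-≤ h h′) (≤-reflexive (lem w c s s′ d d′)))
    where
    lem : ∀ w c s s′ d d′ → w * s + c * d + (w * s′ + c * d′) ≡ w * (s + s′) + c * (d + d′)
    lem = solve-∀

  LowerBound : ℕ → ℕ → ℕ → ℕ → (ℕ → ℕ) → Set
  LowerBound m a w c u = ∀ bs → length bs ≡ m → ∀ x → Bound a w c (smear u bs x) (cost (weight m) bs)

  module _ {p : ℕ} (k : ℕ) {u : ℕ → ℕ} (per : Periodic p u) where

    private
      E : ℕ → ℕ
      E z = u (2 * z)


    -- Each of the nine two-step words leads to a pattern to which `h` applies. The resulting costs
    -- add up to 4 times the old one plus `rotated`, and `decays-rotated` compares this with the old
    -- cost.
    lowerBound-move² : ∀ {m a w c} → 2 ≤ m → 2 ^ m ≡ suc p → LowerBound m a w c u →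
      LowerBound m (9 * suc (rate m) * a) (suc (rate m) * w) (9 * rate m * c) (move k (move k u))
    lowerBound-move² {m} {a} {w} {c} 2≤m e h []           refl x with () ← 2≤m
    lowerBound-move² {m} {a} {w} {c} 2≤m e h (b ∷ [])     refl x with s≤s () ← 2≤m
    lowerBound-move² {m} {a} {w} {c} 2≤m e h (b ∷ b′ ∷ bs) refl x = bound goal
      where
      S R R² R⁺ : List Bool
      S  = b ∷ b′ ∷ bs
      R  = b′ ∷ (bs ∷ʳ b)
      R² = (bs ∷ʳ b) ∷ʳ b′
      R⁺ = b′ ∷ (bs ∷ʳ true)
      M K : ℕ
      M = suc (rate m)
      K = rate m
      κ : List Bool → ℕ
      κ = cost (weight m)
      ∣R∣ : ∀ a → length (b′ ∷ (bs ∷ʳ a)) ≡ m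
      ∣R∣ a = cong suc (length-∷ʳ bs a)
      ∣R²∣ : length R² ≡ m
      ∣R²∣ = trans (length-∷ʳ (bs ∷ʳ b) b′) (∣R∣ b)
      s : ℕ → ℕ
      s = smear u S
      double-then : ∀ c → smear (λ z → u (2 * z + c)) S x ≡ smear u R (2 * x + c)
      double-then c = trans (smear-rotate b (b′ ∷ bs) x (periodic-shift {u = u} c per) e) (smear-shift u c R (2 * x))
      double-double : smear (λ z → u (2 * (2 * z))) S x ≡ smear u R² (2 * (2 * x))
      double-double = trans (smear-rotate b (b′ ∷ bs) x (periodic-double {u = u} per) e)
        (smear-rotate b′ (bs ∷ʳ b) (2 * x) per (trans (cong (2 ^_) (∣R∣ b)) e))
      total : ℕ
      total = smear (move k (move k u)) S x
      inserted = smear-insert {u = u} b (b′ ∷ bs) x per e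
      y y′ : ℕ
      y = inserted .proj₁
      y′ = inserted .proj₂ .proj₁
      -- `a₃` is "+1, then double" and `c₁` is "double, then +1"; they are brought together for
      -- `smear-insert`.
      reorder : ∀ a₁ a₂ a₃ b₁ b₂ b₃ c₁ c₂ c₃ → (a₁ + a₂ + a₃) + (b₁ + b₂ + b₃) + (c₁ + c₂ + c₃)
                ≡ a₁ + a₂ + b₁ + b₂ + b₃ + c₂ + c₃ + (a₃ + c₁)
      reorder = solve-∀
      total≡ : total ≡ s (x + 1 + 1) + s (x + 1 + k) + s (x + k + 1) + s (x + k + k)
                 + smear u R (2 * (x + k)) + smear u R (2 * x + k) + smear u R² (2 * (2 * x))
                 + (smear u R⁺ y + smear u R⁺ y′)
      total≡ = begin
        total
          ≡⟨ smear-move k (move k u) S x ⟩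
        smear (move k u) S (x + 1) + smear (move k u) S (x + k) + smear (λ z → move k u (2 * z)) S x
          ≡⟨ cong₂ _+_ (cong₂ _+_ (smear-move k u S (x + 1)) (smear-move k u S (x + k)))
               (smear-+₃ (λ z → u (2 * z + 1)) (λ z → u (2 * z + k)) (λ z → u (2 * (2 * z))) S x) ⟩
        _ ≡⟨ reorder (s (x + 1 + 1)) (s (x + 1 + k)) (smear E S (x + 1)) (s (x + k + 1)) (s (x + k + k)) (smear E S (x + k))
               (smear (λ z → u (2 * z + 1)) S x) (smear (λ z → u (2 * z + k)) S x) (smear (λ z → u (2 * (2 * z))) S x) ⟩
        _ ≡⟨ cong₂ _+_ (cong₂ _+_ (cong₂ _+_ (cong (s (x + 1 + 1) + s (x + 1 + k) + s (x + k + 1) + s (x + k + k) +_)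
               (smear-rotate {u = u} b (b′ ∷ bs) (x + k) per e)) (double-then k)) double-double) (inserted .proj₂ .proj₂) ⟩
        _ ∎
        where open ≡-Reasoning
      nine : Bound (a + a + a + a + a + a + a + (a + a)) w c total
               (κ S + κ S + κ S + κ S + κ R + κ R + κ R² + (κ R⁺ + κ R⁺))
      nine = subst (λ t → Bound _ w c t (κ S + κ S + κ S + κ S + κ R + κ R + κ R² + (κ R⁺ + κ R⁺))) (sym total≡)
        (hS (x + 1 + 1) ⊕ hS (x + 1 + k) ⊕ hS (x + k + 1) ⊕ hS (x + k + k) ⊕ hR b (2 * (x + k)) ⊕ hR b (2 * x + k)
          ⊕ h R² ∣R²∣ (2 * (2 * x)) ⊕ (hR true y ⊕ hR true y′))
        where
        hS : ∀ x → Bound a w c (s x) (κ S)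
        hS = h S refl
        hR : ∀ a′ x → Bound a w c (smear u (b′ ∷ (bs ∷ʳ a′)) x) (κ (b′ ∷ (bs ∷ʳ a′)))
        hR a′ = h (b′ ∷ (bs ∷ʳ a′)) (∣R∣ a′)
      goal : 9 * M * a ≤ M * w * total + 9 * K * c * κ S
      goal = begin
        9 * M * a ≡⟨ e₁ M a ⟩
        M * (a + a + a + a + a + a + a + (a + a)) ≤⟨ *-monoʳ-≤ M (Bound.holds nine) ⟩
        M * (w * total + c * (κ S + κ S + κ S + κ S + κ R + κ R + κ R² + (κ R⁺ + κ R⁺)))
          ≡⟨ e₂ M w total c (κ S) (κ R) (κ R²) (κ R⁺) ⟩
        M * w * total + c * (M * (4 * κ S + rotated (weight m) b b′ bs))
          ≤⟨ +-monoʳ-≤ (M * w * total) (*-monoʳ-≤ c (Decays.holds (decays-rotated b b′ bs))) ⟩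
        M * w * total + c * (9 * K * κ S) ≡⟨ cong (M * w * total +_) (e₃ c (9 * K) (κ S)) ⟩
        M * w * total + 9 * K * c * κ S ∎
        where
        open ≤-Reasoning
        e₁ : ∀ M a → 9 * M * a ≡ M * (a + a + a + a + a + a + a + (a + a))
        e₁ = solve-∀
        e₂ : ∀ M w t c s r r² r⁺ → M * (w * t + c * (s + s + s + s + r + r + r² + (r⁺ + r⁺)))
               ≡ M * w * t + c * (M * (4 * s + (2 * r + r² + 2 * r⁺)))
        e₂ = solve-∀
        e₃ : ∀ a b c → a * (b * c) ≡ b * a * c
        e₃ = solve-∀

  -- The binary digits of `i` select values of the bits that carry `x` to `x + i`. The descent stops
  -- at the first place without a bit, which alone costs at least `B`.
  smear-or-cost : ∀ {B} (u f : ℕ → ℕ) → (∀ i → B ≤ f i) → ∀ bs x i → i < 2 ^ length bs → 1 ≤ u (x + i) →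
                  1 ≤ smear u bs x ⊎ B ≤ cost f bs
  smear-or-cost u f B≤f []           x i i<1 h = inj₁ (subst (λ j → 1 ≤ u j) lem h)
    where
    lem : x + i ≡ x
    lem = trans (cong (x +_) (n<1⇒n≡0 i<1)) (+-identityʳ x)
  smear-or-cost u f B≤f (false ∷ bs) x i i<  h = inj₂ (≤-trans (B≤f 0) (m≤m+n (f 0) _))
  smear-or-cost u f B≤f (true  ∷ bs) x i i<  h with <-≤-connex i (2 ^ length bs)
  ... | inj₁ i<l with smear-or-cost u (λ i → f (suc i)) (λ i → B≤f (suc i)) bs x i i<l h
  ...   | inj₁ s = inj₁ (≤-trans s (m≤m+n _ _))
  ...   | inj₂ c = inj₂ c
  smear-or-cost u f B≤f (true  ∷ bs) x i i<  h | inj₂ l≤i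
    with smear-or-cost u (λ i → f (suc i)) (λ i → B≤f (suc i)) bs (x + l) (i ∸ l) i∸l<l
           (subst (λ j → 1 ≤ u j) (sym (trans (+-assoc x l (i ∸ l)) (cong (x +_) (m+[n∸m]≡n l≤i)))) h)
    where
    l = 2 ^ length bs
    i∸l<l : i ∸ l < l
    i∸l<l = +-cancelˡ-< l (i ∸ l) l (subst₂ _<_ (sym (m+[n∸m]≡n l≤i)) (cong (l +_) (+-identityʳ l)) i<)
  ... | inj₁ s = inj₁ (≤-trans s (m≤n+m _ _))
  ... | inj₂ c = inj₂ c

  -- Path counts to a fixed endpoint.

  module _ {p : ℕ} .{{_ : NonZero p}} where

    hits : Fin p → ℕ → ℕ
    hits y x = if does (x mod p Fin.≟ y) then 1 else 0

    -- Counts the words of length n leading from x to y. The start is a natural number rather than a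
    -- residue, so that bit weights can be added to it without reduction.
    paths : ℕ → Fin p → ℕ → ℕ → ℕ
    paths k y zero    = hits y
    paths k y (suc n) = move k (paths k y n)

    mod-cong : ∀ {a b} → a % p ≡ b % p → a mod p ≡ b mod p
    mod-cong {a} {b} e = Fin.toℕ-injective
      (trans (Fin.toℕ-fromℕ< (m%n<n a p)) (trans e (sym (Fin.toℕ-fromℕ< (m%n<n b p)))))

    toℕ-mod : ∀ (x : Fin p) → toℕ x mod p ≡ x
    toℕ-mod x = Fin.toℕ-injective (trans (Fin.toℕ-fromℕ< (m%n<n (toℕ x) p)) (m<n⇒m%n≡m (Fin.toℕ<n x)))

    paths-periodic : ∀ k y n → Periodic p (paths k y n)
    paths-periodic k y zero    x = cong (λ z → if does (z Fin.≟ y) then 1 else 0)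
      (mod-cong {x + p} ([m+n]%n≡m%n x p))
    paths-periodic k y (suc n) = periodic-move {u = paths k y n} k (paths-periodic k y n)

    hits-reachable : ∀ y x → ∃[ i ] i < p × hits y (x + i) ≡ 1
    hits-reachable y x = a % p , m%n<n a p , cong (if_then 1 else 0) (dec-true (_ Fin.≟ y) eq)
      where
      -- The residue of y - x; reducing `x` first keeps the subtraction from being truncated.
      a = toℕ y + (p ∸ x % p)
      rearrange : ∀ r q y s → r + q + (y + s) ≡ y + (r + s + q)
      rearrange = solve-∀
      lem : x + a ≡ toℕ y + suc (x / p) * p
      lem = begin
        x + a ≡⟨ cong (_+ a) (m≡m%n+[m/n]*n x p) ⟩
        x % p + x / p * p + a ≡⟨ rearrange (x % p) (x / p * p) (toℕ y) (p ∸ x % p) ⟩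
        toℕ y + (x % p + (p ∸ x % p) + x / p * p)
          ≡⟨ cong (λ z → toℕ y + (z + x / p * p)) (m+[n∸m]≡n (<⇒≤ (m%n<n x p))) ⟩
        toℕ y + suc (x / p) * p ∎
        where open ≡-Reasoning
      eq : (x + a % p) mod p ≡ y
      eq = trans (mod-cong {b = toℕ y} (begin
        (x + a % p) % p ≡⟨ %-distribˡ-+ x (a % p) p ⟩
        (x % p + a % p % p) % p ≡⟨ cong (λ z → (x % p + z) % p) (m%n%n≡m%n a p) ⟩
        (x % p + a % p) % p ≡⟨ %-distribˡ-+ x a p ⟨
        (x + a) % p ≡⟨ cong (_% p) lem ⟩
        (toℕ y + suc (x / p) * p) % p ≡⟨ [m+kn]%n≡m%n (toℕ y) (suc (x / p)) p ⟩
        toℕ y % p ∎)) (toℕ-mod y)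
        where open ≡-Reasoning

    -- Base of the induction. If no place lacks a bit, every offset below p < 2^m is reached;
    -- otherwise a single missing place suffices, because 8m is the least weight.
    lowerBound-hits : ∀ {m} → 2 ^ m ≡ suc p → ∀ y → LowerBound m (8 * m) (8 * m) 1 (hits y)
    lowerBound-hits e y bs refl x with hits-reachable y x
    ... | i , i<p , hit with smear-or-cost (hits y) (weight (length bs)) (8m≤weight (length bs)) bs x i
                               (subst (i <_) (sym e) (m<n⇒m<1+n i<p)) (≤-reflexive (sym hit))
    ...   | inj₁ s = bound (≤-trans (≤-trans (≤-reflexive (sym (*-identityʳ _))) (*-monoʳ-≤ (8 * length bs) s)) (m≤m+n _ _))
    ...   | inj₂ c = bound (≤-trans c (≤-trans (≤-reflexive (sym (*-identityˡ _))) (m≤n+m _ (8 * length bs * smear (hits y) bs x))))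

    -- The length is written `N * 2` so that `suc N * 2` unfolds to two applications of `move`.
    lowerBound-paths : ∀ {m} → 2 ≤ m → 2 ^ m ≡ suc p → ∀ k y N → LowerBound m
      ((9 * suc (rate m)) ^ N * (8 * m)) (suc (rate m) ^ N * (8 * m)) ((9 * rate m) ^ N) (paths k y (N * 2))
    lowerBound-paths {m} 2≤m e k y zero bs l x
      with bound h ← lowerBound-hits e y bs l x = bound (subst₂ _≤_ (sym (*-identityˡ _))
        (cong (λ w → w * smear (hits y) bs x + 1 * cost (weight m) bs) (sym (*-identityˡ (8 * m)))) h)
    lowerBound-paths {m} 2≤m e k y (suc N) bs l x
      with bound h ← lowerBound-move² k (paths-periodic k y (N * 2)) 2≤m e (lowerBound-paths 2≤m e k y N) bs l x
      = bound (subst₂ _≤_ (sym (*-assoc (9 * suc (rate m)) ((9 * suc (rate m)) ^ N) (8 * m)))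
        (cong (λ w → w * smear (paths k y (suc N * 2)) bs x + (9 * rate m) ^ suc N * cost (weight m) bs)
          (sym (*-assoc (suc (rate m)) (suc (rate m) ^ N) (8 * m)))) h)

  -- Decay of the failure probability.

  smear-none : ∀ u m x → smear u (replicate m false) x ≡ 2 ^ m * u x
  smear-none u zero    x = sym (*-identityˡ (u x))
  smear-none u (suc m) x = trans (cong₂ _+_ (smear-none u m x) (smear-none u m x))
    (lem (2 ^ m) (u x))
    where
    lem : ∀ a b → a * b + a * b ≡ 2 * a * b
    lem = solve-∀

  cost≤ : ∀ {B} f bs → (∀ i → i < length bs → f i ≤ B) → cost f bs ≤ length bs * B
  cost≤     f []           h = z≤n
  cost≤ {B} f (true  ∷ bs) h = ≤-trans (cost≤ _ bs (λ i i< → h (suc i) (s≤s i<))) (m≤n+m (length bs * B) B)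
  cost≤     f (false ∷ bs) h = +-mono-≤ (h 0 z<s) (cost≤ _ bs (λ i i< → h (suc i) (s≤s i<)))

  cost-weight≤ : ∀ bs → let m = length bs in cost (weight m) bs ≤ m * (12 * m)
  cost-weight≤ bs = cost≤ (weight m) bs λ i i<m → ≤-trans (weight≤ m i)
    (≤-trans (+-monoʳ-≤ (9 * m) (*-monoʳ-≤ 3 (<⇒≤ i<m))) (≤-reflexive (sym (*-distribʳ-+ m 9 3))))
    where m = length bs

  ^-distribʳ-* : ∀ n a b → (a * b) ^ n ≡ a ^ n * b ^ n
  ^-distribʳ-* zero    a b = refl
  ^-distribʳ-* (suc n) a b = trans (cong (a * b *_) (^-distribʳ-* n a b)) (lem a b (a ^ n) (b ^ n))
    where
    lem : ∀ a b c d → a * b * (c * d) ≡ a * c * (b * d)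
    lem = solve-∀

  -- Bernoulli's inequality for (1 + 1/K)^(n+1), multiplied by K^(n+1).
  bernoulli : ∀ K n → (K + suc n) * K ^ n ≤ suc K ^ suc n
  bernoulli K zero    = ≤-reflexive (lem K)
    where
    lem : ∀ K → (K + 1) * 1 ≡ suc K * 1
    lem = solve-∀
  bernoulli K (suc n) = begin
    (K + suc (suc n)) * (K * K ^ n) ≤⟨ m≤m+n _ (suc n * K ^ n) ⟩
    (K + suc (suc n)) * (K * K ^ n) + suc n * K ^ n ≡⟨ lem K n (K ^ n) ⟩
    suc K * ((K + suc n) * K ^ n) ≤⟨ *-monoʳ-≤ (suc K) (bernoulli K n) ⟩
    suc K * suc K ^ suc n ∎
    where
    open ≤-Reasoning
    lem : ∀ K n a → (K + (2 + n)) * (K * a) + (1 + n) * a ≡ (1 + K) * ((K + (1 + n)) * a)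
    lem = solve-∀

  -- By Bernoulli, (1 - 1/(K + 1))^(K+1) ≤ 1/2, so every K + 1 blocks halve the failure bound.
  halving : ∀ K L → 2 ^ L * K ^ (suc K * L) ≤ suc K ^ (suc K * L)
  halving K L = begin
    2 ^ L * K ^ (suc K * L)     ≡⟨ cong (2 ^ L *_) (^-*-assoc K (suc K) L) ⟨
    2 ^ L * (K ^ suc K) ^ L     ≡⟨ ^-distribʳ-* L 2 (K ^ suc K) ⟨
    (2 * K ^ suc K) ^ L         ≤⟨ ^-monoˡ-≤ L (≤-trans (≤-trans (≤-reflexive (lem K (K ^ K)))
                                     (*-monoˡ-≤ (K ^ K) (+-monoʳ-≤ K (n≤1+n K)))) (bernoulli K K)) ⟩
    (suc K ^ suc K) ^ L         ≡⟨ ^-*-assoc (suc K) (suc K) L ⟩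
    suc K ^ (suc K * L)         ∎
    where
    open ≤-Reasoning
    lem : ∀ K a → 2 * (K * a) ≡ (K + K) * a
    lem = solve-∀

  module _ {p : ℕ} .{{_ : NonZero p}} where

    -- The walk starts without bits, where the smear is 2^m times the count. The initial cost is at
    -- most 12m² in units of 8m, that is 3m/2; the N blocks divide it by at least 2^L, and
    -- `9 * m ≤ 2 * 2 ^ L` leaves a failing share of at most 1/3.
    paths-spread : ∀ {m} L → 2 ≤ m → 2 ^ m ≡ suc p → 9 * m ≤ 2 * 2 ^ L → ∀ k y x →
      let N = suc (rate m) * L in 2 * 9 ^ N ≤ 3 * (2 ^ m * paths {p} k y (N * 2) x)
    paths-spread {m} L 2≤m e 9m≤ k y x = +-cancelʳ-≤ (9 ^ N) _ _
      (*-cancelʳ-≤ _ _ (M ^ N * (8 * m))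
        {{m*n≢0 (M ^ N) (8 * m) {{m^n≢0 M N}} {{m*n≢0 8 m {{_}} {{>-nonZero (<-≤-trans z<s 2≤m)}}}}}} main)
      where
      K = rate m
      M = suc K
      N = M * L
      c = paths k y (N * 2) x
      ∣∅∣ : length (replicate m false) ≡ m
      ∣∅∣ = length-replicate m
      lower : (9 * M) ^ N * (8 * m) ≤ M ^ N * (8 * m) * (2 ^ m * c) + (9 * K) ^ N * (m * (12 * m))
      lower with bound h ← lowerBound-paths 2≤m e k y N (replicate m false) ∣∅∣ x =
        ≤-trans h (+-mono-≤ (≤-reflexive (cong (M ^ N * (8 * m) *_) (smear-none (paths k y (N * 2)) m x)))
          (*-monoʳ-≤ ((9 * K) ^ N)
          (subst (λ l → cost (weight l) (replicate m false) ≤ l * (12 * l)) ∣∅∣ (cost-weight≤ (replicate m false)))))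
      small : K ^ N * (9 * m) ≤ 2 * M ^ N
      small = begin
        K ^ N * (9 * m)       ≤⟨ *-monoʳ-≤ (K ^ N) 9m≤ ⟩
        K ^ N * (2 * 2 ^ L)   ≡⟨ lem (K ^ N) (2 ^ L) ⟩
        2 * (2 ^ L * K ^ N)   ≤⟨ *-monoʳ-≤ 2 (halving K L) ⟩
        2 * M ^ N             ∎
        where
        open ≤-Reasoning
        lem : ∀ a b → a * (2 * b) ≡ 2 * (b * a)
        lem = solve-∀
      -- The summand `9 ^ N` on both sides is the failing third, added instead of subtracted.
      main : (2 * 9 ^ N + 9 ^ N) * (M ^ N * (8 * m)) ≤ (3 * (2 ^ m * c) + 9 ^ N) * (M ^ N * (8 * m))
      main = begin
        (2 * 9 ^ N + 9 ^ N) * (M ^ N * (8 * m)) ≡⟨ e₁ (9 ^ N) (M ^ N) m ⟩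
        3 * (9 ^ N * M ^ N * (8 * m)) ≡⟨ cong (λ z → 3 * (z * (8 * m))) (^-distribʳ-* N 9 M) ⟨
        3 * ((9 * M) ^ N * (8 * m)) ≤⟨ *-monoʳ-≤ 3 lower ⟩
        3 * (M ^ N * (8 * m) * (2 ^ m * c) + (9 * K) ^ N * (m * (12 * m)))
          ≡⟨ cong (λ z → 3 * (M ^ N * (8 * m) * (2 ^ m * c) + z * (m * (12 * m)))) (^-distribʳ-* N 9 K) ⟩
        3 * (M ^ N * (8 * m) * (2 ^ m * c) + 9 ^ N * K ^ N * (m * (12 * m)))
          ≡⟨ e₂ (M ^ N) m (2 ^ m * c) (9 ^ N) (K ^ N) ⟩
        3 * (2 ^ m * c) * (M ^ N * (8 * m)) + 9 ^ N * (4 * m) * (K ^ N * (9 * m))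
          ≤⟨ +-monoʳ-≤ (3 * (2 ^ m * c) * (M ^ N * (8 * m))) (*-monoʳ-≤ (9 ^ N * (4 * m)) small) ⟩
        3 * (2 ^ m * c) * (M ^ N * (8 * m)) + 9 ^ N * (4 * m) * (2 * M ^ N)
          ≡⟨ e₃ (3 * (2 ^ m * c)) (M ^ N) m (9 ^ N) ⟩
        (3 * (2 ^ m * c) + 9 ^ N) * (M ^ N * (8 * m)) ∎
        where
        open ≤-Reasoning
        e₁ : ∀ a b m → (2 * a + a) * (b * (8 * m)) ≡ 3 * (a * b * (8 * m))
        e₁ = solve-∀
        e₂ : ∀ b m q a k → 3 * (b * (8 * m) * q + a * k * (m * (12 * m))) ≡ 3 * q * (b * (8 * m)) + a * (4 * m) * (k * (9 * m))
        e₂ = solve-∀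
        e₃ : ∀ q b m a → q * (b * (8 * m)) + a * (4 * m) * (2 * b) ≡ (q + a) * (b * (8 * m))
        e₃ = solve-∀

  dyadic : ∀ m → 1 ≤ m → ∃[ ℓ ] 2 ^ ℓ ≤ m × m < 2 ^ suc ℓ
  dyadic (suc zero)    _ = 0 , ≤-refl , ≤-refl
  dyadic (suc (suc m)) _ with dyadic (suc m) z<s
  ... | ℓ , lo , hi with suc (suc m) <? 2 ^ suc ℓ
  ...   | yes lt = ℓ , m≤n⇒m≤1+n lo , lt
  ...   | no ¬lt = suc ℓ , ≮⇒≥ ¬lt , ≤-trans (s≤s hi)
          (≤-trans (+-monoˡ-≤ (2 ^ suc ℓ) (>-nonZero⁻¹ _ {{m^n≢0 2 (suc ℓ)}})) (≤-reflexive (cong (2 ^ suc ℓ +_) (sym (+-identityʳ _)))))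

-- From path counts to separation distance.

module Separation where

  open PathCounting using (paths; toℕ-mod; paths-periodic; paths-spread)
  open import Data.Nat.Base as ℕ using (ℕ; zero; suc)
  import Data.Nat.Properties as ℕ
  import Data.Nat.DivMod as ℕ
  open import Data.Nat.Tactic.RingSolver using (solve-∀)
  open import Data.Fin.Base using (Fin; zero; suc; toℕ)
  import Data.Fin.Properties as Fin
  open import Data.Bool.Base using (true; false; if_then_else_)
  open import Data.Integer.Base as ℤ using (+_)
  import Data.Integer.Properties as ℤ
  open import Data.Rational.Base
  open import Data.Rational.Properties
  import Data.Rational.Unnormalised.Base as ℚᵘ
  import Data.Rational.Unnormalised.Properties as ℚᵘ
  open import Data.Rational.Solver using (module +-*-Solver)
  open import Data.Product.Base using (∃-syntax; _×_; _,_)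
  open import Algebra.Bundles using (CommutativeRing)
  open import Algebra.Properties.Semiring.Sum (CommutativeRing.semiring +-*-commutativeRing)
    using (sum-syntax; sum-cong-≗; ∑-distrib-+; *-distribˡ-sum; sum-replicate-zero)
  open import Relation.Nullary.Decidable using (Dec; does; yes; no)
  open import Relation.Nullary.Negation using (contradiction)
  open import Relation.Binary.PropositionalEquality

  fromℕ≃ : ∀ n → toℚᵘ (fromℕ n) ℚᵘ.≃ ℚᵘ.mkℚᵘ (+ n) 0
  fromℕ≃ n = toℚᵘ-fromℚᵘ (ℚᵘ.mkℚᵘ (+ n) 0)

  fromℕ-+ : ∀ m n → fromℕ (m ℕ.+ n) ≡ fromℕ m + fromℕ n
  fromℕ-+ m n = toℚᵘ-injective (ℚᵘ.≃-trans (fromℕ≃ (m ℕ.+ n)) (ℚᵘ.≃-sym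
    (ℚᵘ.≃-trans (toℚᵘ-homo-+ (fromℕ m) (fromℕ n))
      (ℚᵘ.≃-trans (ℚᵘ.+-cong (fromℕ≃ m) (fromℕ≃ n)) (ℚᵘ.*≡* (cong (ℤ._* + 1)
        (cong₂ ℤ._+_ (ℤ.*-identityʳ (+ m)) (ℤ.*-identityʳ (+ n)))))))))

  fromℕ-* : ∀ m n → fromℕ (m ℕ.* n) ≡ fromℕ m * fromℕ n
  fromℕ-* m n = toℚᵘ-injective (ℚᵘ.≃-trans (fromℕ≃ (m ℕ.* n)) (ℚᵘ.≃-sym
    (ℚᵘ.≃-trans (toℚᵘ-homo-* (fromℕ m) (fromℕ n))
      (ℚᵘ.≃-trans (ℚᵘ.*-cong (fromℕ≃ m) (fromℕ≃ n)) (ℚᵘ.*≡* (cong (ℤ._* + 1) (sym (ℤ.pos-* m n))))))))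

  0≤fromℕ : ∀ n → 0ℚ ≤ fromℕ n
  0≤fromℕ n = nonNegative⁻¹ (fromℕ n) {{normalize-nonNeg n 1}}

  0<fromℕ : ∀ n .{{_ : ℕ.NonZero n}} → 0ℚ < fromℕ n
  0<fromℕ n@(suc _) = positive⁻¹ (fromℕ n) {{normalize-pos n 1}}

  fromℕ-mono-≤ : ∀ {m n} → m ℕ.≤ n → fromℕ m ≤ fromℕ n
  fromℕ-mono-≤ {m} {n} m≤n = subst₂ _≤_ (+-identityʳ (fromℕ m))
    (trans (sym (fromℕ-+ m (n ℕ.∸ m))) (cong fromℕ (ℕ.m+[n∸m]≡n m≤n)))
    (+-monoʳ-≤ (fromℕ m) (0≤fromℕ (n ℕ.∸ m)))

  /-*-cancel : ∀ a n .{{_ : ℕ.NonZero n}} → (+ a / n) * fromℕ n ≡ fromℕ a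
  /-*-cancel a n@(suc n-1) = toℚᵘ-injective
    (ℚᵘ.≃-trans (toℚᵘ-homo-* (+ a / n) (fromℕ n))
    (ℚᵘ.≃-trans (ℚᵘ.*-cong (toℚᵘ-fromℚᵘ (ℚᵘ.mkℚᵘ (+ a) n-1)) (fromℕ≃ n))
    (ℚᵘ.≃-trans (ℚᵘ.*≡* (ℤ.*-assoc (+ a) (+ n) (+ 1))) (ℚᵘ.≃-sym (fromℕ≃ a)))))

  sum-indicator-* : ∀ {N} (a : Fin N) (f : Fin N → ℚ) → ∑[ z < N ] (indicator a z * f z) ≡ f a
  sum-indicator-* {suc N} zero    f = begin
    1ℚ * f zero + ∑[ z < N ] (0ℚ * f (suc z)) ≡⟨ cong (λ s → 1ℚ * f zero + s) (sum-cong-≗ (λ z → *-zeroˡ (f (suc z)))) ⟩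
    1ℚ * f zero + ∑[ z < N ] 0ℚ             ≡⟨ cong₂ _+_ (*-identityˡ (f zero)) (sum-replicate-zero N) ⟩
    f zero + 0ℚ                             ≡⟨ +-identityʳ (f zero) ⟩
    f zero                                  ∎
    where open ≡-Reasoning
  sum-indicator-* {suc N} (suc a) f =
    trans (cong (_+ ∑[ z < N ] (indicator a z * f (suc z))) (*-zeroˡ (f zero)))
      (trans (+-identityˡ _) (sum-indicator-* a (λ z → f (suc z))))

  module _ {p : ℕ} (odd : p ℕ.% 2 ≡ 1) (k : Fin p) where

    private
      instance
        p≢0 : ℕ.NonZero p
        p≢0 = Fin.nonZeroIndex k

    open MarkovChain (pollardRho odd k) using (P^; SeparationWithin)

    P^-suc : ∀ n x y → P^ (suc n) x y
               ≡ + 1 / 3 * (P^ n (shift 1 x) y + P^ n (shift (toℕ k) x) y + P^ n (double x) y)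
    P^-suc n x y = begin
      ∑[ z < p ] (+ 1 / 3 * (i₁ z + i₂ z + i₃ z) * f z)
        ≡⟨ sum-cong-≗ (λ z → split (+ 1 / 3) (i₁ z) (i₂ z) (i₃ z) (f z)) ⟩
      ∑[ z < p ] (+ 1 / 3 * (i₁ z * f z + i₂ z * f z + i₃ z * f z))
        ≡⟨ *-distribˡ-sum (+ 1 / 3) (λ z → i₁ z * f z + i₂ z * f z + i₃ z * f z) ⟨
      + 1 / 3 * ∑[ z < p ] (i₁ z * f z + i₂ z * f z + i₃ z * f z)
        ≡⟨ cong (+ 1 / 3 *_) (trans (∑-distrib-+ (λ z → i₁ z * f z + i₂ z * f z) (λ z → i₃ z * f z))
             (cong₂ _+_ (trans (∑-distrib-+ (λ z → i₁ z * f z) (λ z → i₂ z * f z))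
               (cong₂ _+_ (sum-indicator-* (shift 1 x) f) (sum-indicator-* (shift (toℕ k) x) f)))
               (sum-indicator-* (double x) f))) ⟩
      + 1 / 3 * (f (shift 1 x) + f (shift (toℕ k) x) + f (double x)) ∎
      where
      open ≡-Reasoning
      i₁ i₂ i₃ f : Fin p → ℚ
      i₁ = indicator (shift 1 x)
      i₂ = indicator (shift (toℕ k) x)
      i₃ = indicator (double x)
      f z = P^ n z y
      split : ∀ t a b c f → t * (a + b + c) * f ≡ t * (a * f + b * f + c * f)
      split = solve 5 (λ t a b c f → t :* (a :+ b :+ c) :* f := t :* (a :* f :+ b :* f :+ c :* f)) refl
        where open +-*-Solver

    paths-mod : ∀ (y : Fin p) n a → paths (toℕ k) y n (toℕ (a ℕ.mod p)) ≡ paths (toℕ k) y n a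
    paths-mod y n a = begin
      u (toℕ (a ℕ.mod p))                  ≡⟨ cong u (Fin.toℕ-fromℕ< (ℕ.m%n<n a p)) ⟩
      u (a ℕ.% p)                          ≡⟨ multiples (a ℕ./ p) (a ℕ.% p) ⟨
      u (a ℕ.% p ℕ.+ a ℕ./ p ℕ.* p)        ≡⟨ cong u (ℕ.m≡m%n+[m/n]*n a p) ⟨
      u a                                  ∎
      where
      open ≡-Reasoning
      u = paths (toℕ k) y n
      multiples : ∀ q r → u (r ℕ.+ q ℕ.* p) ≡ u r
      multiples zero    r = cong u (ℕ.+-identityʳ r)
      multiples (suc q) r = trans (cong u (trans (cong (r ℕ.+_) (ℕ.+-comm p (q ℕ.* p)))
        (sym (ℕ.+-assoc r (q ℕ.* p) p)))) (trans (paths-periodic (toℕ k) y n _) (multiples q r))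

    -- Both recursions peel off the first step of the walk, so they agree up to the factor 3 per
    -- step.
    P^-paths : ∀ n x y → fromℕ (3 ℕ.^ n) * P^ n x y ≡ fromℕ (paths (toℕ k) y n (toℕ x))
    P^-paths zero    x y = trans (*-identityˡ (indicator x y))
      (trans (cast (does (x Fin.≟ y))) (cong (λ z → fromℕ (if does (z Fin.≟ y) then 1 else 0)) (sym (toℕ-mod x))))
      where
      cast : ∀ b → (if b then 1ℚ else 0ℚ) ≡ fromℕ (if b then 1 else 0)
      cast true  = refl
      cast false = refl
    P^-paths (suc n) x y = begin
      fromℕ (3 ℕ.* 3 ℕ.^ n) * P^ (suc n) x y
        ≡⟨ cong₂ _*_ (fromℕ-* 3 (3 ℕ.^ n)) (P^-suc n x y) ⟩
      fromℕ 3 * T * (+ 1 / 3 * (P₁ + P₂ + P₃))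
        ≡⟨ rearrange (fromℕ 3) T (+ 1 / 3) P₁ P₂ P₃ ⟩
      + 1 / 3 * fromℕ 3 * (T * P₁ + T * P₂ + T * P₃)
        -- `+ 1 / 3 * fromℕ 3` evaluates to `1ℚ`.
        ≡⟨ *-identityˡ (T * P₁ + T * P₂ + T * P₃) ⟩
      T * P₁ + T * P₂ + T * P₃
        ≡⟨ cong₂ _+_ (cong₂ _+_ (step (shift 1 x) (toℕ x ℕ.+ 1) refl) (step (shift (toℕ k) x) (toℕ x ℕ.+ toℕ k) refl))
             (step (double x) (2 ℕ.* toℕ x) refl) ⟩
      fromℕ (u (toℕ x ℕ.+ 1)) + fromℕ (u (toℕ x ℕ.+ toℕ k)) + fromℕ (u (2 ℕ.* toℕ x))
        ≡⟨ trans (fromℕ-+ (u (toℕ x ℕ.+ 1) ℕ.+ u (toℕ x ℕ.+ toℕ k)) _)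
             (cong (_+ fromℕ (u (2 ℕ.* toℕ x))) (fromℕ-+ (u (toℕ x ℕ.+ 1)) _)) ⟨
      fromℕ (paths (toℕ k) y (suc n) (toℕ x)) ∎
      where
      open ≡-Reasoning
      u = paths (toℕ k) y n
      T P₁ P₂ P₃ : ℚ
      T = fromℕ (3 ℕ.^ n)
      P₁ = P^ n (shift 1 x) y
      P₂ = P^ n (shift (toℕ k) x) y
      P₃ = P^ n (double x) y
      step : ∀ z a → z ≡ a ℕ.mod p → T * P^ n z y ≡ fromℕ (u a)
      step z a refl = trans (P^-paths n z y) (cong fromℕ (paths-mod y n a))
      rearrange : ∀ a t c x y z → a * t * (c * (x + y + z)) ≡ c * a * (t * x + t * y + t * z)
      rearrange = solve 6 (λ a t c x y z → a :* t :* (c :* (x :+ y :+ z)) := c :* a :* (t :* x :+ t :* y :+ t :* z)) refl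
        where open +-*-Solver

    -- Since π is 1/p, the claim is p * P ≥ 1/2; multiplied by 2 * 3^n it becomes the hypothesis on
    -- counts.
    paths⇒separation : ∀ n → (∀ x (y : Fin p) → 3 ℕ.^ n ℕ.≤ 2 ℕ.* p ℕ.* paths (toℕ k) y n x) → SeparationWithin ½ n
    paths⇒separation n h x y = +-monoʳ-≤ 1ℚ (neg-antimono-≤ ½≤P÷π)
      where
      u T P pq : ℚ
      u = + 1 / p
      T = fromℕ (3 ℕ.^ n)
      P = P^ n x y
      pq = fromℕ p
      instance
        u-pos : Positive u
        u-pos = normalize-pos 1 p
        u-nz : NonZero u
        u-nz = pos⇒nonZero u
      _÷π : ℚ → ℚ
      q ÷π = (q ÷ u)
      pu≡1 : u * pq ≡ 1ℚ
      pu≡1 = /-*-cancel 1 p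
      T≤ : T * 1ℚ ≤ T * (fromℕ 2 * pq * P)
      T≤ = subst₂ _≤_ (sym (*-identityʳ T)) (begin
          fromℕ (2 ℕ.* p ℕ.* c) ≡⟨ trans (fromℕ-* (2 ℕ.* p) c) (cong (_* fromℕ c) (fromℕ-* 2 p)) ⟩
          fromℕ 2 * pq * fromℕ c ≡⟨ cong (fromℕ 2 * pq *_) (P^-paths n x y) ⟨
          fromℕ 2 * pq * (T * P) ≡⟨ swap (fromℕ 2 * pq) T P ⟩
          T * (fromℕ 2 * pq * P) ∎)
        (fromℕ-mono-≤ (h (toℕ x) y))
        where
        open ≡-Reasoning
        c = paths (toℕ k) y n (toℕ x)
        swap : ∀ a b c → a * (b * c) ≡ b * (a * c)
        swap = solve 3 (λ a b c → a :* (b :* c) := b :* (a :* c)) refl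
          where open +-*-Solver
      1≤ : 1ℚ ≤ fromℕ 2 * pq * P
      1≤ = *-cancelˡ-≤-pos T {{positive (0<fromℕ (3 ℕ.^ n) {{ℕ.m^n≢0 3 n}})}} T≤
      ½u≤P : ½ * u ≤ P
      ½u≤P = subst₂ _≤_ (*-identityʳ (½ * u)) eq
        (*-monoˡ-≤-nonNeg (½ * u) {{nonNegative {½ * u} (subst (_≤ ½ * u) (*-zeroʳ ½) (*-monoˡ-≤-nonNeg ½ (<⇒≤ (positive⁻¹ u))))}} 1≤)
        where
        eq : ½ * u * (fromℕ 2 * pq * P) ≡ P
        eq = trans (lem ½ u (fromℕ 2) pq P) (trans (cong (λ z → ½ * fromℕ 2 * z * P) pu≡1)
          (*-identityˡ P))
          where
          open +-*-Solver
          lem : ∀ h u t q P → h * u * (t * q * P) ≡ h * t * (u * q) * P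
          lem = solve 5 (λ h u t q P → h :* u :* (t :* q :* P) := h :* t :* (u :* q) :* P) refl
      ½≤P÷π : ½ ≤ P ÷π
      ½≤P÷π = *-cancelʳ-≤-pos u (subst (½ * u ≤_) (sym (trans (*-assoc P (1/ u) u)
        (trans (cong (P *_) (*-inverseˡ u)) (*-identityʳ P)))) ½u≤P)

    -- Decidability lets `least` find the mixing time as an actual minimum below a known witness.
    separationWithin? : ∀ ε n → Dec (SeparationWithin ε n)
    separationWithin? ε n = Fin.all? λ x → Fin.all? λ y → _ ≤? ε

  least : ∀ {P : ℕ → Set} → (∀ n → Dec (P n)) → ∀ n → P n → ∃[ τ ] P τ × (∀ n → P n → τ ℕ.≤ n)
  least P? n Pn with P? 0
  ... | yes P0 = 0 , P0 , λ _ _ → ℕ.z≤n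
  least P? zero    P0 | no ¬P0 with () ← ¬P0 P0
  least P? (suc n) Pn | no ¬P0 with least (λ n → P? (suc n)) n Pn
  ... | τ , Pτ , min = suc τ , Pτ , λ { zero P0 → contradiction P0 ¬P0 ; (suc n) Pn → ℕ.s≤s (min n Pn) }

  suc-mersenne : ∀ m → suc (mersenne m) ≡ 2 ℕ.^ m
  suc-mersenne m = ℕ.m+[n∸m]≡n (ℕ.>-nonZero⁻¹ (2 ℕ.^ m) {{ℕ.m^n≢0 2 m}})

  3≤mersenne : ∀ {m} → 2 ℕ.≤ m → 3 ℕ.≤ mersenne m
  3≤mersenne 2≤m = ℕ.∸-monoˡ-≤ 1 (ℕ.^-monoʳ-≤ 2 2≤m)

  rounds : ℕ → ℕ → ℕ
  rounds m L = suc (40 ℕ.* m) ℕ.* L ℕ.* 2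

  -- The counts are at least 2/3 of 9^N / (p + 1), and p ≥ 3 gives p/(p + 1) ≥ 3/4; the ratio to
  -- uniform is then at least 2/3 * 3/4 = 1/2.
  separation-after : ∀ {m} (2≤m : 2 ℕ.≤ m) L → 9 ℕ.* m ℕ.≤ 2 ℕ.* 2 ℕ.^ L → ∀ k →
    MarkovChain.SeparationWithin (pollardRho (mersenne-odd 2≤m) k) ½ (rounds m L)
  separation-after {m} 2≤m L 9m≤ k = paths⇒separation (mersenne-odd 2≤m) k (N ℕ.* 2) λ x y →
    ℕ.*-cancelˡ-≤ 2 (begin
      2 ℕ.* 3 ℕ.^ (N ℕ.* 2)      ≡⟨ cong (2 ℕ.*_) (trans (cong (3 ℕ.^_) (ℕ.*-comm N 2)) (sym (ℕ.^-*-assoc 3 2 N))) ⟩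
      2 ℕ.* 9 ℕ.^ N              ≤⟨ paths-spread L 2≤m (sym (suc-mersenne m)) 9m≤ (toℕ k) y x ⟩
      3 ℕ.* (2 ℕ.^ m ℕ.* c y x)  ≡⟨ cong (λ q → 3 ℕ.* (q ℕ.* c y x)) (sym (suc-mersenne m)) ⟩
      3 ℕ.* (suc p ℕ.* c y x)    ≡⟨ e₁ p (c y x) ⟩
      3 ℕ.* c y x ℕ.+ 3 ℕ.* (p ℕ.* c y x) ≤⟨ ℕ.+-monoˡ-≤ (3 ℕ.* (p ℕ.* c y x)) (ℕ.*-monoˡ-≤ (c y x) (3≤mersenne 2≤m)) ⟩
      p ℕ.* c y x ℕ.+ 3 ℕ.* (p ℕ.* c y x) ≡⟨ e₂ p (c y x) ⟩
      2 ℕ.* (2 ℕ.* p ℕ.* c y x)  ∎)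
    where
    open ℕ.≤-Reasoning
    instance
      p≢0 : ℕ.NonZero (mersenne m)
      p≢0 = Fin.nonZeroIndex k
    p = mersenne m
    N = suc (40 ℕ.* m) ℕ.* L
    c : Fin (mersenne m) → ℕ → ℕ
    c y x = paths (toℕ k) y (N ℕ.* 2) x
    e₁ : ∀ p c → 3 ℕ.* (suc p ℕ.* c) ≡ 3 ℕ.* c ℕ.+ 3 ℕ.* (p ℕ.* c)
    e₁ = solve-∀
    e₂ : ∀ p c → p ℕ.* c ℕ.+ 3 ℕ.* (p ℕ.* c) ≡ 2 ℕ.* (2 ℕ.* p ℕ.* c)
    e₂ = solve-∀

-- Lower bounds for log p and log log p.

module LogarithmBounds where

  open PathCounting using (dyadic)
  open Separation
  open import Data.Nat.Base as ℕ using (ℕ; zero; suc)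
  import Data.Nat.Properties as ℕ
  open import Data.Nat.Tactic.RingSolver using (solve-∀)
  open import Data.Fin.Base using (Fin)
  open import Data.Integer.Base using (+_)
  open import Data.Rational.Base
  open import Data.Rational.Properties
  open import Data.Rational.Solver using (module +-*-Solver)
  open import Data.Product.Base using (∃-syntax; _×_; _,_)
  open import Data.Sum.Base using (inj₁; inj₂)
  open import Algebra.Definitions.RawSemiring +-*-rawSemiring using (_^_)
  open import Relation.Nullary.Decidable using (from-yes)
  open import Relation.Binary.PropositionalEquality
    using (_≡_; refl; sym; trans; cong; subst; subst₂)

  *-monoˡ : ∀ {a b c} → 0ℚ ≤ a → b ≤ c → a * b ≤ a * c
  *-monoˡ {a} 0≤a = *-monoˡ-≤-nonNeg a {{nonNegative 0≤a}}

  *-mono : ∀ {a b c d} → 0ℚ ≤ a → 0ℚ ≤ d → a ≤ b → c ≤ d → a * c ≤ b * d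
  *-mono {d = d} 0≤a 0≤d a≤b c≤d = ≤-trans (*-monoˡ 0≤a c≤d) (*-monoʳ-≤-nonNeg d {{nonNegative 0≤d}} a≤b)

  0≤* : ∀ {a b} → 0ℚ ≤ a → 0ℚ ≤ b → 0ℚ ≤ a * b
  0≤* {a} {b} 0≤a 0≤b = subst (_≤ a * b) (*-zeroʳ a) (*-monoˡ 0≤a 0≤b)

  p≤p+q : ∀ {p q} → 0ℚ ≤ q → p ≤ p + q
  p≤p+q {p} {q} 0≤q = subst (_≤ p + q) (+-identityʳ p) (+-monoʳ-≤ p 0≤q)

  p≤∣p∣ : ∀ p → p ≤ ∣ p ∣
  p≤∣p∣ p with ≤-total 0ℚ p
  ... | inj₁ 0≤p = ≤-reflexive (sym (0≤p⇒∣p∣≡p 0≤p))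
  ... | inj₂ p≤0 = ≤-trans p≤0 (0≤∣p∣ p)

  p≤q⇒0≤q-p : ∀ {p q} → p ≤ q → 0ℚ ≤ q - p
  p≤q⇒0≤q-p {p} {q} p≤q = subst (_≤ q - p) (+-inverseʳ p) (+-monoˡ-≤ (- p) p≤q)

  ÷-*-cancel : ∀ a b .{{_ : NonZero b}} → (a ÷ b) * b ≡ a
  ÷-*-cancel a b = trans (*-assoc a (1/ b) b) (trans (cong (a *_) (*-inverseˡ b)) (*-identityʳ a))

  -- Replacing q by ∣y∣ in the last hypothesis adds ∣y∣ - q on the right and, as s ≤ 1, at most that
  -- on the left.
  cayley-≥ : ∀ {s q y} → s ≤ 1ℚ → q ≤ y → s * (q + 1ℚ) ≤ q - 1ℚ → s ≤ cayley y
  cayley-≥ {s} {q} {y} s≤1 q≤y h = *-cancelʳ-≤-pos (a + 1ℚ) {{a+1-pos}}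
    (subst (s * (a + 1ℚ) ≤_) (sym cayley-*) (subst₂ _≤_ (e₁ s q a 1ℚ) (e₂ q a 1ℚ) (+-mono-≤ h s*[a-q]≤a-q)))
    where
    a = ∣ y ∣
    a+1-pos : Positive (a + 1ℚ)
    a+1-pos = positive (+-mono-≤-< (0≤∣p∣ y) (positive⁻¹ 1ℚ))
    cayley-* : cayley y * (a + 1ℚ) ≡ a - 1ℚ
    cayley-* = ÷-*-cancel (a - 1ℚ) (a + 1ℚ) {{pos⇒nonZero (a + 1ℚ) {{a+1-pos}}}}
    s*[a-q]≤a-q : s * (a - q) ≤ a - q
    s*[a-q]≤a-q = subst (s * (a - q) ≤_) (*-identityˡ (a - q))
      (*-monoʳ-≤-nonNeg (a - q) {{nonNegative (p≤q⇒0≤q-p (≤-trans q≤y (p≤∣p∣ y)))}} s≤1)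
    open +-*-Solver
    e₁ : ∀ s q a o → s * (q + o) + s * (a - q) ≡ s * (a + o)
    e₁ = solve 4 (λ s q a o → s :* (q :+ o) :+ s :* (a :- q) := s :* (a :+ o)) refl
    e₂ : ∀ q a o → q - o + (a - q) ≡ a - o
    e₂ = solve 3 (λ q a o → q :- o :+ (a :- q) := a :- o) refl

  0≤^ : ∀ {t} n → 0ℚ ≤ t → 0ℚ ≤ t ^ n
  0≤^ zero    0≤t = nonNegative⁻¹ 1ℚ
  0≤^ (suc n) 0≤t = 0≤* 0≤t (0≤^ n 0≤t)

  ^-mono : ∀ {s t} n → 0ℚ ≤ s → s ≤ t → s ^ n ≤ t ^ n
  ^-mono zero    0≤s s≤t = ≤-refl
  ^-mono (suc n) 0≤s s≤t = *-mono 0≤s (0≤^ n (≤-trans 0≤s s≤t)) s≤t (^-mono n 0≤s s≤t)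

  0≤coefficient : ∀ j → 0ℚ ≤ + 2 / suc (2 ℕ.* j)
  0≤coefficient j = nonNegative⁻¹ _ {{normalize-nonNeg 2 (suc (2 ℕ.* j))}}

  logSum-mono : ∀ {s t} n → 0ℚ ≤ s → s ≤ t → logSum n s ≤ logSum n t
  logSum-mono zero    0≤s s≤t = ≤-refl
  logSum-mono (suc n) 0≤s s≤t = +-mono-≤ (logSum-mono n 0≤s s≤t)
    (*-monoˡ (0≤coefficient n) (^-mono (suc (2 ℕ.* n)) 0≤s s≤t))

  logSum-monoᵗ : ∀ {t m n} → 0ℚ ≤ t → m ℕ.≤ n → logSum m t ≤ logSum n t
  logSum-monoᵗ {t} {m} 0≤t m≤n = go (ℕ.≤⇒≤′ m≤n)
    where
    go : ∀ {n} → m ℕ.≤′ n → logSum m t ≤ logSum n t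
    go ℕ.≤′-refl = ≤-refl
    go (ℕ.≤′-step {n} m≤n) = ≤-trans (go m≤n)
      (p≤p+q (0≤* (0≤coefficient n) (0≤^ (suc (2 ℕ.* n)) 0≤t)))

  logSum-≥ : ∀ {s y k n} → 0ℚ ≤ s → s ≤ cayley y → k ℕ.≤ n → logSum k s ≤ logSum n (cayley y)
  logSum-≥ {k = k} 0≤s s≤t k≤n = ≤-trans (logSum-mono k 0≤s s≤t) (logSum-monoᵗ (≤-trans 0≤s s≤t) k≤n)

  bernoulliℚ : ∀ {w} n → 0ℚ ≤ w → w ≤ 1ℚ → 1ℚ - fromℕ n * w ≤ (1ℚ - w) ^ n
  bernoulliℚ {w} zero    0≤w w≤1 = ≤-reflexive (trans (cong (λ z → 1ℚ - z) (*-zeroˡ w)) (+-identityʳ 1ℚ))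
  bernoulliℚ {w} (suc n) 0≤w w≤1 = begin
    1ℚ - fromℕ (suc n) * w                        ≡⟨ cong (λ z → 1ℚ - z * w) (fromℕ-+ 1 n) ⟩
    1ℚ - (1ℚ + k) * w                             ≤⟨ p≤p+q (0≤* (0≤* (0≤fromℕ n) 0≤w) 0≤w) ⟩
    1ℚ - (1ℚ + k) * w + k * w * w                 ≡⟨ e k w ⟩
    (1ℚ - w) * (1ℚ - k * w)                       ≤⟨ *-monoˡ (p≤q⇒0≤q-p w≤1) (bernoulliℚ n 0≤w w≤1) ⟩
    (1ℚ - w) * (1ℚ - w) ^ n                       ∎
    where
    open ≤-Reasoning
    k = fromℕ n
    e : ∀ k w → 1ℚ - (1ℚ + k) * w + k * w * w ≡ (1ℚ - w) * (1ℚ - k * w)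
    e = solve 2 (λ k w → con 1ℚ :- (con 1ℚ :+ k) :* w :+ k :* w :* w := (con 1ℚ :- w) :* (con 1ℚ :- k :* w)) refl
      where open +-*-Solver

  logTerm-≥ : ∀ {t} J .{{_ : ℕ.NonZero J}} j → suc (2 ℕ.* j) ℕ.≤ J → ½ ≤ t ^ suc (2 ℕ.* j) → + 1 / J ≤ logTerm t j
  logTerm-≥ {t} J j i≤J ½≤ = ≤-trans v≤ (*-monoˡ (0≤coefficient j) ½≤)
    where
    i = suc (2 ℕ.* j)
    v≤ : + 1 / J ≤ + 2 / i * ½
    v≤ = *-cancelʳ-≤-pos (fromℕ i) {{positive (0<fromℕ i)}} (begin
      + 1 / J * fromℕ i       ≤⟨ *-monoˡ (nonNegative⁻¹ (+ 1 / J) {{normalize-nonNeg 1 J}}) (fromℕ-mono-≤ i≤J) ⟩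
      + 1 / J * fromℕ J       ≡⟨ /-*-cancel 1 J ⟩
      1ℚ                      ≡⟨⟩
      fromℕ 2 * ½             ≡⟨ cong (_* ½) (/-*-cancel 2 i) ⟨
      + 2 / i * fromℕ i * ½   ≡⟨ swap (+ 2 / i) (fromℕ i) ½ ⟩
      + 2 / i * ½ * fromℕ i   ∎)
      where
      open ≤-Reasoning
      swap : ∀ a b c → a * b * c ≡ a * c * b
      swap = solve 3 (λ a b c → a :* b :* c := a :* c :* b) refl
        where open +-*-Solver

  logSum-+-≥ : ∀ {t v} n k → (∀ j → j ℕ.< k ℕ.+ n → v ≤ logTerm t j) → logSum n t + fromℕ k * v ≤ logSum (k ℕ.+ n) t
  logSum-+-≥ {t} {v} n zero    h = ≤-reflexive (trans (cong (λ z → logSum n t + z) (*-zeroˡ v)) (+-identityʳ _))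
  logSum-+-≥ {t} {v} n (suc k) h = begin
    logSum n t + fromℕ (suc k) * v     ≡⟨ cong (λ z → logSum n t + z * v) (fromℕ-+ 1 k) ⟩
    logSum n t + (1ℚ + fromℕ k) * v    ≡⟨ e (logSum n t) (fromℕ k) v ⟩
    logSum n t + fromℕ k * v + v
      ≤⟨ +-mono-≤ (logSum-+-≥ n k (λ j j< → h j (ℕ.m≤n⇒m≤1+n j<))) (h (k ℕ.+ n) ℕ.≤-refl) ⟩
    logSum (suc k ℕ.+ n) t             ∎
    where
    open ≤-Reasoning
    e : ∀ s k v → s + (1ℚ + k) * v ≡ s + k * v + v
    e = solve 3 (λ s k v → s :+ (con 1ℚ :+ k) :* v := s :+ k :* v :+ v) refl
      where open +-*-Solver

  ¼ : ℚ
  ¼ = + 1 / 4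

  -- The terms with 2^b ≤ j < 2^(b+1) contribute at least 1/4.
  logSum-dyadic : ∀ {t} b → (∀ j → j ℕ.< 2 ℕ.^ b → ½ ≤ t ^ suc (2 ℕ.* j)) → 0ℚ ≤ t →
                  fromℕ b * ¼ ≤ logSum (2 ℕ.^ b) t
  logSum-dyadic {t} zero    h 0≤t = ≤-trans (≤-reflexive (*-zeroˡ ¼)) (logSum-monoᵗ {t} {0} {1} 0≤t ℕ.z≤n)
  logSum-dyadic {t} (suc b) h 0≤t = begin
    fromℕ (suc b) * ¼                        ≡⟨ trans (cong (_* ¼) (fromℕ-+ 1 b)) (*-distribʳ-+ ¼ 1ℚ (fromℕ b)) ⟩
    1ℚ * ¼ + fromℕ b * ¼                     ≡⟨ +-comm (1ℚ * ¼) (fromℕ b * ¼) ⟩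
    fromℕ b * ¼ + 1ℚ * ¼
      ≤⟨ +-mono-≤ (logSum-dyadic b (λ j j< → h j (ℕ.<-≤-trans j< (ℕ.m≤m+n J (J ℕ.+ 0)))) 0≤t)
           (≤-reflexive (sym J/4J)) ⟩
    -- For j < 2J the denominator 2j + 1 is below 4J, so each of the J new terms is at least 1/(4J).
    logSum J t + fromℕ J * (+ 1 / (4 ℕ.* J)) ≤⟨ logSum-+-≥ J J term ⟩
    logSum (J ℕ.+ J) t                       ≡⟨ cong (λ i → logSum (J ℕ.+ i) t) (ℕ.+-identityʳ J) ⟨
    logSum (2 ℕ.* J) t                       ∎
    where
    open ≤-Reasoning
    J = 2 ℕ.^ b
    instance
      J≢0 : ℕ.NonZero J
      J≢0 = ℕ.m^n≢0 2 b
      4J≢0 : ℕ.NonZero (4 ℕ.* J)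
      4J≢0 = ℕ.m*n≢0 4 J
    term : ∀ j → j ℕ.< J ℕ.+ J → + 1 / (4 ℕ.* J) ≤ logTerm t j
    term j j<2J = logTerm-≥ {t} (4 ℕ.* J) j (ℕ.≤-trans (ℕ.≤-trans (ℕ.n≤1+n _) (ℕ.≤-reflexive (e₁ j)))
      (ℕ.≤-trans (ℕ.*-monoʳ-≤ 2 j<2J) (ℕ.≤-reflexive (e₂ J))))
      (h j (subst (λ i → j ℕ.< J ℕ.+ i) (sym (ℕ.+-identityʳ J)) j<2J))
      where
      e₁ : ∀ j → suc (suc (2 ℕ.* j)) ≡ 2 ℕ.* suc j
      e₁ = solve-∀
      e₂ : ∀ J → 2 ℕ.* (J ℕ.+ J) ≡ 4 ℕ.* J
      e₂ = solve-∀
    J/4J : fromℕ J * (+ 1 / (4 ℕ.* J)) ≡ 1ℚ * ¼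
    J/4J = trans (lem (fromℕ J) (+ 1 / (4 ℕ.* J)))
      (cong (_* ¼) (trans (cong (+ 1 / (4 ℕ.* J) *_) (sym (fromℕ-* 4 J))) (/-*-cancel 1 (4 ℕ.* J))))
      where
      lem : ∀ a b → a * b ≡ b * (fromℕ 4 * a) * ¼
      lem = solve 2 (λ a b → a :* b := b :* (con (fromℕ 4) :* a) :* con ¼) refl
        where open +-*-Solver

  -- With J = 2^b and y ≥ 8J, 1 - 2/(y + 1) ≥ 1 - 1/(4J), whose powers up to exponent 2J are at
  -- least 1/2 by Bernoulli.
  logSum-power : ∀ {y n} b → fromℕ (2 ℕ.^ (3 ℕ.+ b)) ≤ y → 2 ℕ.^ b ℕ.≤ n → fromℕ b * ¼ ≤ logSum n (cayley y)
  logSum-power {y} b q≤y 2^b≤n = ≤-trans (logSum-dyadic b half 0≤s)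
    (logSum-≥ {y = y} 0≤s (cayley-≥ s≤1 q≤y s*[q+1]≤q-1) 2^b≤n)
    where
    J = 2 ℕ.^ b
    Q = 4 ℕ.* J
    instance
      J≢0 : ℕ.NonZero J
      J≢0 = ℕ.m^n≢0 2 b
      Q≢0 : ℕ.NonZero Q
      Q≢0 = ℕ.m*n≢0 4 J
    w s q : ℚ
    w = + 1 / Q
    s = 1ℚ - w
    q = fromℕ (2 ℕ.^ (3 ℕ.+ b))
    0≤w : 0ℚ ≤ w
    0≤w = nonNegative⁻¹ w {{normalize-nonNeg 1 Q}}
    wQ≡1 : w * fromℕ Q ≡ 1ℚ
    wQ≡1 = /-*-cancel 1 Q
    w≤1 : w ≤ 1ℚ
    w≤1 = subst₂ _≤_ (*-identityʳ w) wQ≡1 (*-monoˡ 0≤w (fromℕ-mono-≤ (ℕ.>-nonZero⁻¹ Q)))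
    0≤s : 0ℚ ≤ s
    0≤s = p≤q⇒0≤q-p w≤1
    s≤1 : s ≤ 1ℚ
    s≤1 = subst (s ≤_) (+-identityʳ 1ℚ) (+-monoʳ-≤ 1ℚ (neg-antimono-≤ 0≤w))
    s*[q+1]≤q-1 : s * (q + 1ℚ) ≤ q - 1ℚ
    s*[q+1]≤q-1 = begin
      s * (q + 1ℚ)      ≤⟨ p≤p+q 0≤w ⟩
      s * (q + 1ℚ) + w  ≡⟨ e₁ w q ⟩
      q + 1ℚ - w * q    ≡⟨ cong (λ z → q + 1ℚ - z) wq ⟩
      q + 1ℚ - fromℕ 2  ≡⟨ e₂ q ⟩
      q - 1ℚ            ∎
      where
      open ≤-Reasoning
      open +-*-Solver
      e₁ : ∀ w q → (1ℚ - w) * (q + 1ℚ) + w ≡ q + 1ℚ - w * q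
      e₁ = solve 2 (λ w q → (con 1ℚ :- w) :* (q :+ con 1ℚ) :+ w := q :+ con 1ℚ :- w :* q) refl
      e₂ : ∀ q → q + 1ℚ - fromℕ 2 ≡ q - 1ℚ
      e₂ = solve 1 (λ q → q :+ con 1ℚ :- con (fromℕ 2) := q :- con 1ℚ) refl
      wq : w * q ≡ fromℕ 2
      wq = trans (cong (w *_) (trans (cong fromℕ (lem J)) (fromℕ-* Q 2)))
        (trans (sym (*-assoc w (fromℕ Q) (fromℕ 2))) (cong (_* fromℕ 2) wQ≡1))
        where
        lem : ∀ J → 2 ℕ.* (2 ℕ.* (2 ℕ.* J)) ≡ 4 ℕ.* J ℕ.* 2
        lem = solve-∀
    half : ∀ j → j ℕ.< J → ½ ≤ s ^ suc (2 ℕ.* j)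
    half j j<J = ≤-trans ½≤ (bernoulliℚ i 0≤w w≤1)
      where
      i = suc (2 ℕ.* j)
      i≤2J : i ℕ.≤ 2 ℕ.* J
      i≤2J = ℕ.≤-trans (ℕ.≤-trans (ℕ.n≤1+n i) (ℕ.≤-reflexive (e j))) (ℕ.*-monoʳ-≤ 2 j<J)
        where
        e : ∀ j → suc (suc (2 ℕ.* j)) ≡ 2 ℕ.* suc j
        e = solve-∀
      wi≤½ : fromℕ i * w ≤ ½
      wi≤½ = begin
        fromℕ i * w            ≤⟨ *-monoʳ-≤-nonNeg w {{nonNegative 0≤w}} (fromℕ-mono-≤ i≤2J) ⟩
        fromℕ (2 ℕ.* J) * w    ≡⟨ e₃ (fromℕ (2 ℕ.* J)) w ⟩
        w * (fromℕ 2 * fromℕ (2 ℕ.* J)) * ½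
          ≡⟨ cong (λ z → w * z * ½) (trans (sym (fromℕ-* 2 (2 ℕ.* J))) (cong fromℕ (sym (ℕ.*-assoc 2 2 J)))) ⟩
        w * fromℕ Q * ½        ≡⟨ cong (_* ½) wQ≡1 ⟩
        ½                      ∎
        where
        open ≤-Reasoning
        e₃ : ∀ a w → a * w ≡ w * (fromℕ 2 * a) * ½
        e₃ = solve 2 (λ a w → a :* w := w :* (con (fromℕ 2) :* a) :* con ½) refl
          where open +-*-Solver
      ½≤ : ½ ≤ 1ℚ - fromℕ i * w
      ½≤ = +-monoʳ-≤ 1ℚ (neg-antimono-≤ wi≤½)

  -- At t = 1/2, which is `cayley` of 3, the first two terms are 1 and 1/12. The sum exceeds 1,
  -- which keeps the second logarithm away from 0.
  logSum-3 : ∀ {y n} → fromℕ 3 ≤ y → 2 ℕ.≤ n → + 13 / 12 ≤ logSum n (cayley y)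
  logSum-3 {y} 3≤y 2≤n = logSum-≥ {½} {y} {2} (from-yes (0ℚ ≤? ½)) (cayley-≥ (from-yes (½ ≤? 1ℚ)) 3≤y
    (from-yes (½ * (fromℕ 3 + 1ℚ) ≤? fromℕ 3 - 1ℚ))) 2≤n

  -- `cayley` of 13/12 is 1/25, and the first term doubles it.
  logSum-13/12 : ∀ {y n} → + 13 / 12 ≤ y → 1 ℕ.≤ n → + 2 / 25 ≤ logSum n (cayley y)
  logSum-13/12 {y} q≤y 1≤n = logSum-≥ {+ 1 / 25} {y} {1} (from-yes (0ℚ ≤? + 1 / 25))
    (cayley-≥ (from-yes (+ 1 / 25 ≤? 1ℚ)) q≤y
      (from-yes (+ 1 / 25 * (+ 13 / 12 + 1ℚ) ≤? + 13 / 12 - 1ℚ))) 1≤n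

  -- Cross-multiplication for a/c ≤ b/d, with `u` and `v` as the reciprocals.
  fromℕ-*-≤ : ∀ {a b} c d → a ℕ.* d ℕ.≤ b ℕ.* c → ∀ {u v} → fromℕ c * u ≡ 1ℚ → fromℕ d * v ≡ 1ℚ → 0ℚ ≤ u → 0ℚ ≤ v →
              fromℕ a * u ≤ fromℕ b * v
  fromℕ-*-≤ {a} {b} c d ad≤bc {u} {v} cu dv 0≤u 0≤v = begin
    fromℕ a * u                    ≡⟨ trans (sym (*-identityʳ _)) (cong (fromℕ a * u *_) (sym dv)) ⟩
    fromℕ a * u * (fromℕ d * v)    ≡⟨ swap (fromℕ a) u (fromℕ d) v ⟩
    fromℕ a * fromℕ d * (u * v)    ≡⟨ cong (_* (u * v)) (fromℕ-* a d) ⟨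
    fromℕ (a ℕ.* d) * (u * v)      ≤⟨ *-monoʳ-≤-nonNeg (u * v) {{nonNegative (0≤* 0≤u 0≤v)}} (fromℕ-mono-≤ ad≤bc) ⟩
    fromℕ (b ℕ.* c) * (u * v)      ≡⟨ cong (_* (u * v)) (fromℕ-* b c) ⟩
    fromℕ b * fromℕ c * (u * v)    ≡⟨ swap′ (fromℕ b) (fromℕ c) u v ⟩
    fromℕ b * v * (fromℕ c * u)    ≡⟨ trans (cong (fromℕ b * v *_) cu) (*-identityʳ _) ⟩
    fromℕ b * v                    ∎
    where
    open ≤-Reasoning
    open +-*-Solver
    swap : ∀ a u d v → a * u * (d * v) ≡ a * d * (u * v)
    swap = solve 4 (λ a u d v → a :* u :* (d :* v) := a :* d :* (u :* v)) refl
    swap′ : ∀ b c u v → b * c * (u * v) ≡ b * v * (c * u)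
    swap′ = solve 4 (λ b c u v → b :* c :* (u :* v) := b :* v :* (c :* u)) refl

  n≤2^n : ∀ n → n ℕ.≤ 2 ℕ.^ n
  n≤2^n zero    = ℕ.z≤n
  n≤2^n (suc n) = ℕ.≤-trans (ℕ.+-mono-≤ (ℕ.>-nonZero⁻¹ (2 ℕ.^ n) {{ℕ.m^n≢0 2 n}}) (n≤2^n n))
    (ℕ.≤-reflexive (cong (2 ℕ.^ n ℕ.+_) (sym (ℕ.+-identityʳ (2 ℕ.^ n)))))

  2^m≤mersenne : ∀ m → 2 ℕ.^ m ℕ.≤ mersenne (suc m)
  2^m≤mersenne m = ℕ.≤-pred (ℕ.≤-trans
    (ℕ.+-monoˡ-≤ (2 ℕ.^ m) (ℕ.>-nonZero⁻¹ (2 ℕ.^ m) {{ℕ.m^n≢0 2 m}}))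
    (ℕ.≤-reflexive (trans (cong (2 ℕ.^ m ℕ.+_) (sym (ℕ.+-identityʳ (2 ℕ.^ m)))) (sym (suc-mersenne (suc m))))))

  -- For m ≤ 8, m/8 ≤ 1 < 13/12. For larger m, p ≥ 2^(m-1) = 2^(3+b) with b = m - 4, and (m - 4)/4 ≥
  -- m/8.
  log-mersenne-≥ : ∀ m n → 2 ℕ.≤ m → 2 ℕ.^ m ℕ.≤ n → fromℕ m * (+ 1 / 8) ≤ logSum n (cayley (fromℕ (mersenne m)))
  log-mersenne-≥ m n 2≤m 2^m≤n with ℕ.≤-total m 8
  ... | inj₁ m≤8 = ≤-trans (*-monoʳ-≤-nonNeg (+ 1 / 8) (fromℕ-mono-≤ m≤8))
    (≤-trans (from-yes (fromℕ 8 * (+ 1 / 8) ≤? + 13 / 12)) (logSum-3 {fromℕ (mersenne m)} (fromℕ-mono-≤ (3≤mersenne 2≤m))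
      (ℕ.≤-trans (ℕ.≤-trans 2≤m (n≤2^n m)) 2^m≤n)))
  ... | inj₂ 8≤m = ≤-trans (fromℕ-*-≤ {m} {b} 8 4 m*4≤b*8 refl refl (from-yes (0ℚ ≤? + 1 / 8)) (from-yes (0ℚ ≤? ¼)))
      (logSum-power {fromℕ (mersenne m)} b
        (fromℕ-mono-≤ (subst (λ m → 2 ℕ.^ (3 ℕ.+ b) ℕ.≤ mersenne m) 4+b≡m (2^m≤mersenne (3 ℕ.+ b))))
        (ℕ.≤-trans (ℕ.^-monoʳ-≤ 2 (ℕ.m∸n≤m m 4)) 2^m≤n))
    where
    b = m ℕ.∸ 4
    4+b≡m : 4 ℕ.+ b ≡ m
    4+b≡m = ℕ.m+[n∸m]≡n (ℕ.≤-trans (ℕ.m≤m+n 4 4) 8≤m)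
    m*4≤b*8 : m ℕ.* 4 ℕ.≤ b ℕ.* 8
    m*4≤b*8 = subst (λ m → m ℕ.* 4 ℕ.≤ b ℕ.* 8) 4+b≡m
      (ℕ.≤-trans (ℕ.*-monoˡ-≤ 4 (ℕ.+-monoˡ-≤ b (ℕ.∸-monoˡ-≤ 4 8≤m))) (ℕ.≤-reflexive (e b)))
      where
      e : ∀ b → (b ℕ.+ b) ℕ.* 4 ≡ b ℕ.* 8
      e = solve-∀

  -- Applied to y near log p ≥ m/8 ≥ 2^ℓ/8. For ℓ ≤ 12 the constant 200 is chosen to make 16/200 =
  -- 2/25; for larger ℓ, 2^ℓ/8 = 2^(3+b) with b = ℓ - 6.
  logSum-eighth-≥ : ∀ {y} ℓ n → + 13 / 12 ≤ y → fromℕ (2 ℕ.^ ℓ) * (+ 1 / 8) ≤ y → 2 ℕ.^ ℓ ℕ.≤ n →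
                    fromℕ (ℓ ℕ.+ 4) * (+ 1 / 200) ≤ logSum n (cayley y)
  logSum-eighth-≥ {y} ℓ n h₁ h₂ 2^ℓ≤n with ℕ.≤-total ℓ 12
  ... | inj₁ ℓ≤12 = ≤-trans (*-monoʳ-≤-nonNeg (+ 1 / 200) (fromℕ-mono-≤ (ℕ.+-monoˡ-≤ 4 ℓ≤12)))
    (≤-trans (from-yes (fromℕ 16 * (+ 1 / 200) ≤? + 2 / 25)) (logSum-13/12 h₁
      (ℕ.≤-trans (ℕ.>-nonZero⁻¹ (2 ℕ.^ ℓ) {{ℕ.m^n≢0 2 ℓ}}) 2^ℓ≤n)))
  ... | inj₂ 12≤ℓ =
    ≤-trans (fromℕ-*-≤ {ℓ ℕ.+ 4} {b} 200 4 [ℓ+4]*4≤b*200 refl refl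
        (from-yes (0ℚ ≤? + 1 / 200)) (from-yes (0ℚ ≤? ¼)))
      (logSum-power {y} b (≤-trans (≤-reflexive (sym eighth)) h₂)
        (ℕ.≤-trans (ℕ.^-monoʳ-≤ 2 (ℕ.m∸n≤m ℓ 6)) 2^ℓ≤n))
    where
    b = ℓ ℕ.∸ 6
    6+b≡ℓ : 6 ℕ.+ b ≡ ℓ
    6+b≡ℓ = ℕ.m+[n∸m]≡n (ℕ.≤-trans (ℕ.m≤m+n 6 6) 12≤ℓ)
    [ℓ+4]*4≤b*200 : (ℓ ℕ.+ 4) ℕ.* 4 ℕ.≤ b ℕ.* 200
    [ℓ+4]*4≤b*200 = subst (λ ℓ → (ℓ ℕ.+ 4) ℕ.* 4 ℕ.≤ b ℕ.* 200) 6+b≡ℓ (ℕ.≤-trans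
      (ℕ.*-monoˡ-≤ 4 (ℕ.+-mono-≤ (ℕ.+-monoˡ-≤ b 6≤b) (ℕ.≤-trans (ℕ.m≤m+n 4 2) 6≤b)))
      (ℕ.≤-trans (ℕ.≤-reflexive (e b)) (ℕ.*-monoʳ-≤ b (ℕ.m≤m+n 12 188))))
      where
      6≤b : 6 ℕ.≤ b
      6≤b = ℕ.∸-monoˡ-≤ 6 12≤ℓ
      e : ∀ b → (b ℕ.+ b ℕ.+ b) ℕ.* 4 ≡ b ℕ.* 12
      e = solve-∀
    eighth : fromℕ (2 ℕ.^ ℓ) * (+ 1 / 8) ≡ fromℕ (2 ℕ.^ (3 ℕ.+ b))
    eighth = trans (cong (_* (+ 1 / 8)) (trans (cong fromℕ 2^ℓ≡) (fromℕ-* (2 ℕ.^ (3 ℕ.+ b)) 8)))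
      (trans (*-assoc (fromℕ (2 ℕ.^ (3 ℕ.+ b))) (fromℕ 8) (+ 1 / 8)) (*-identityʳ (fromℕ (2 ℕ.^ (3 ℕ.+ b)))))
      where
      2^ℓ≡ : 2 ℕ.^ ℓ ≡ 2 ℕ.^ (3 ℕ.+ b) ℕ.* 8
      2^ℓ≡ = trans (cong (2 ℕ.^_) (trans (sym 6+b≡ℓ) (ℕ.+-comm 3 (3 ℕ.+ b)))) (ℕ.^-distribˡ-+-* 2 (3 ℕ.+ b) 3)

  -- The constant and the final estimate.

  rounds-≤ : ∀ m L → 1 ℕ.≤ m → rounds m L ℕ.≤ 82 ℕ.* (m ℕ.* L)
  rounds-≤ m L 1≤m = ℕ.≤-trans (ℕ.*-monoˡ-≤ 2 (ℕ.*-monoˡ-≤ L (ℕ.+-monoˡ-≤ (40 ℕ.* m) 1≤m))) (ℕ.≤-reflexive (e m L))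
    where
    e : ∀ m L → (m ℕ.+ 40 ℕ.* m) ℕ.* L ℕ.* 2 ≡ 82 ℕ.* (m ℕ.* L)
    e = solve-∀

  9m≤2^ : ∀ {m ℓ} → m ℕ.< 2 ℕ.^ suc ℓ → 9 ℕ.* m ℕ.≤ 2 ℕ.* 2 ℕ.^ (ℓ ℕ.+ 4)
  9m≤2^ {m} {ℓ} m< = ℕ.≤-trans (ℕ.*-monoˡ-≤ m (ℕ.m≤m+n 9 7)) (ℕ.≤-trans (ℕ.*-monoʳ-≤ 16 (ℕ.<⇒≤ m<))
    (ℕ.≤-reflexive (trans (e (2 ℕ.^ ℓ)) (cong (2 ℕ.*_) (sym (ℕ.^-distribˡ-+-* 2 ℓ 4))))))
    where
    e : ∀ a → 16 ℕ.* (2 ℕ.* a) ≡ 2 ℕ.* (a ℕ.* 16)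
    e = solve-∀

  -- 82 comes from `rounds-≤`, 8 and 200 from the bounds on log p and log log p.
  scale : ℚ
  scale = fromℕ 82 * fromℕ 8 * fromℕ 200

  scale-* : ∀ m L {x y} → fromℕ m * (+ 1 / 8) ≤ x → fromℕ L * (+ 1 / 200) ≤ y →
            fromℕ (82 ℕ.* (m ℕ.* L)) ≤ scale * x * y
  scale-* m L {x} {y} m/8≤x L/200≤y = begin
    fromℕ (82 ℕ.* (m ℕ.* L))
      ≡⟨ trans (fromℕ-* 82 (m ℕ.* L)) (cong (fromℕ 82 *_) (fromℕ-* m L)) ⟩
    fromℕ 82 * (fromℕ m * fromℕ L)
      ≡⟨ e (fromℕ m) (fromℕ L) ⟩
    scale * (fromℕ m * (+ 1 / 8) * (fromℕ L * (+ 1 / 200)))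
      ≤⟨ *-monoˡ (from-yes (0ℚ ≤? scale)) (*-mono 0≤m/8 0≤y m/8≤x L/200≤y) ⟩
    scale * (x * y)
      ≡⟨ *-assoc scale x y ⟨
    scale * x * y ∎
    where
    open ≤-Reasoning
    0≤m/8 : 0ℚ ≤ fromℕ m * (+ 1 / 8)
    0≤m/8 = 0≤* (0≤fromℕ m) (from-yes (0ℚ ≤? + 1 / 8))
    0≤y : 0ℚ ≤ y
    0≤y = ≤-trans (0≤* {fromℕ L} {+ 1 / 200} (0≤fromℕ L) (from-yes (0ℚ ≤? + 1 / 200))) L/200≤y
    e : ∀ a b → fromℕ 82 * (a * b) ≡ scale * (a * (+ 1 / 8) * (b * (+ 1 / 200)))
    e = solve 2 (λ a b → con (fromℕ 82) :* (a :* b) := con scale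
          :* (a :* con (+ 1 / 8) :* (b :* con (+ 1 / 200)))) refl
      where open +-*-Solver

  -- Both logarithms are approximated at the same index n, as in the nested `log`, and the bound
  -- holds for every n ≥ 2^m, when the partial sums are long enough.
  mixingTime-≤ : ∀ m (2≤m : 2 ℕ.≤ m) (k : Fin (mersenne m)) →
    ∃[ τ ] IsSeparationMixingTime (pollardRho (mersenne-odd 2≤m) k) ½ τ
           × (∀ {n} → 2 ℕ.^ m ℕ.≤ n → let y = logSum n (cayley (fromℕ (mersenne m))) in
                fromℕ τ ≤ scale * y * logSum n (cayley y))
  mixingTime-≤ m 2≤m k =
    let ℓ , 2^ℓ≤m , m<2^1+ℓ = dyadic m (ℕ.<⇒≤ 2≤m)
        L = ℓ ℕ.+ 4
        separated = separation-after 2≤m L (9m≤2^ {m} {ℓ} m<2^1+ℓ) k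
        τ , mixed , minimal = least (separationWithin? (mersenne-odd 2≤m) k ½) (rounds m L) separated
    in τ , (mixed , minimal) , λ {n} 2^m≤n →
      let y = logSum n (cayley (fromℕ (mersenne m)))
          m≤n = ℕ.≤-trans (n≤2^n m) 2^m≤n
          m/8≤y = log-mersenne-≥ m n 2≤m 2^m≤n
          13/12≤y = logSum-3 {fromℕ (mersenne m)} (fromℕ-mono-≤ (3≤mersenne 2≤m)) (ℕ.≤-trans 2≤m m≤n)
          L/200≤ = logSum-eighth-≥ {y} ℓ n 13/12≤y
            (≤-trans (*-monoʳ-≤-nonNeg (+ 1 / 8) (fromℕ-mono-≤ 2^ℓ≤m)) m/8≤y)
            (ℕ.≤-trans 2^ℓ≤m m≤n)
      in ≤-trans (fromℕ-mono-≤ (ℕ.≤-trans (minimal (rounds m L) separated) (rounds-≤ m L (ℕ.<⇒≤ 2≤m))))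
           (scale-* m L m/8≤y L/200≤)

open import Data.Nat.Base using (ℕ; _≤_; _^_)
open import Data.Fin.Base using (Fin)
open import Data.Rational.Base using (½)
import Data.Rational.Properties as ℚ
open import Data.Product.Base using (∃-syntax; _×_; _,_)

theorem4p2 :
    ∃[ C ] ∀ (m : ℕ) (2≤m : 2 ≤ m) (k : Fin (mersenne m)) →
      let p     = fromℕᴿ (mersenne m)
          1<p   = 1<fromℕᴿ (2≤mersenne 2≤m)
          log-p = log p (1<⇒0< p 1<p)
      in ∃[ τ ] IsSeparationMixingTime (pollardRho (mersenne-odd 2≤m) k) ½ τ
                × fromℕᴿ τ ≤ᴿ C *ᴿ log-p *ᴿ log log-p (0<log p 1<p)
theorem4p2 = fromℚᴿ LogarithmBounds.scale , λ m 2≤m k →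
  let τ , isMixingTime , τ≤ = LogarithmBounds.mixingTime-≤ m 2≤m k
  -- From index 2^m on the approximations satisfy the inequality exactly; ε is mere slack.
  in τ , isMixingTime , λ ε 0<ε → 2 ^ m , λ 2^m≤n →
       ℚ.≤-trans (τ≤ 2^m≤n) (LogarithmBounds.p≤p+q (ℚ.<⇒≤ 0<ε))
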